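{- Let $G$ be a biconnected graph. Then: (1) $\chi(G)\le\chi(G')=\max_{A\in\mathrm{Part}(G)}\chi(G'(A))$. (2) $\chi(G)\le\max_{A\in\mathrm{Part}(G)}\chi(G(A))+1$. (3) $\chi(G)\le\max\bigl(3,\ \max_{A}\chi(G(A))+1\bigr)$, where the inner maximum ranges over the parts $A\in\mathrm{Part}(G)$ that are blocks.
   Context: All graphs are finite, undirected, without loops or multiple edges; $G(U)$ is the subgraph induced on $U$; $\chi$ is the chromatic number. A connected component means the vertex set of a maximal connected subgraph. A set $R\subset V(G)$ is a cutset if $G-R$ (delete the vertices of $R$) is disconnected; $\mathfrak R_2(G)$ is the set of 2-vertex cutsets. $R$ separates $X$ from $Y$ (where $X,Y\not\subset R$) if no vertex of $X\setminus R$ and no vertex of $Y\setminus R$ lie in a common connected component of $G-R$; $R$ splits $X$ if $X\setminus R$ is not contained in one connected component of $G-R$. $G$ is $k$-connected if $v(G)>k$ and it has no cutset with at most $k-1$ vertices; biconnected = 2-connected, triconnected = 3-connected. Cutsets $S,T\in\mathfrak R_2(G)$ are independent if neither splits the other; $S$ is single if it is independent with all other cutsets in $\mathfrak R_2(G)$; $\mathfrak O(G)$ is the set of single cutsets. A set $A\subset V(G)$ is a part of $G$ if no cutset of $\mathfrak O(G)$ splits $A$ but every vertex outside $A$ is separated from $A$ by some cutset of $\mathfrak O(G)$; $\mathrm{Part}(G)$ is the set of parts. $G'$ is obtained from $G$ by adding all edges $ab$ with $\{a,b\}\in\mathfrak O(G)$. A part $A$ is a block if $G'(A)$ is triconnected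 (every part is either a block or has $G'(A)$ a simple cycle). The maximum over an empty set is taken to be $-\infty$. -}

module Defs where

open import Data.Nat using (ℕ; zero; suc; _≤_; _<_; _⊔_)
open import Data.Fin using (Fin)
open import Data.Fin.Subset using (Subset; _∈_; _∉_; _⊆_; _⊈_; _─_; ∣_∣; ⁅_⁆; ⊤)
open import Data.Product using (Σ; _×_; ∃; ∃-syntax; _,_)
open import Data.Sum using (_⊎_)
open import Relation.Nullary using (¬_; Dec)
open import Relation.Binary.PropositionalEquality using (_≡_; _≢_)

-- A (finite, simple) graph is given by its vertex set Fin n and an
-- adjacency relation E.  Every notion below is relative to a vertex set
-- W : Subset n, so that (E , W) is the graph induced on W.
-- Thus G = (E , ⊤), G(A) = (E , A), G' = (E' , ⊤), G'(A) = (E' , A).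

Rel : ℕ → Set₁
Rel n = Fin n → Fin n → Set

record IsSimpleGraph {n : ℕ} (E : Rel n) : Set where
  field
    sym     : ∀ u v → E u v → E v u
    irrefl  : ∀ v → ¬ E v v
    dec     : ∀ u v → Dec (E u v)

data Reach {n : ℕ} (E : Rel n) (X : Subset n) : Fin n → Fin n → Set where
  here : ∀ {u} → u ∈ X → Reach E X u u
  step : ∀ {u w v} → u ∈ X → E u w → Reach E X w v → Reach E X u v

Disconnected : {n : ℕ} → Rel n → Subset n → Set
Disconnected E X = ∃[ u ] ∃[ v ] (u ∈ X × v ∈ X × ¬ Reach E X u v)

IsCutset : {n : ℕ} → Rel n → Subset n → Subset n → Set
IsCutset E W R = R ⊆ W × Disconnected E (W ─ R)

IsCutset2 : {n : ℕ} → Rel n → Subset n → Subset n → Set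
IsCutset2 E W R = IsCutset E W R × ∣ R ∣ ≡ 2

Separates : {n : ℕ} → Rel n → Subset n → Subset n → Subset n → Subset n → Set
Separates E W R X Y =
  X ⊈ R × Y ⊈ R ×
  (∀ x y → x ∈ X → x ∉ R → y ∈ Y → y ∉ R → ¬ Reach E (W ─ R) x y)

Splits : {n : ℕ} → Rel n → Subset n → Subset n → Subset n → Set
Splits E W R X =
  ∃[ x ] ∃[ y ] (x ∈ X × x ∉ R × y ∈ X × y ∉ R × ¬ Reach E (W ─ R) x y)

IsKConnected : {n : ℕ} → ℕ → Rel n → Subset n → Set
IsKConnected k E W =
  k < ∣ W ∣ × (∀ R → ∣ R ∣ < k → ¬ IsCutset E W R)

Biconnected : {n : ℕ} → Rel n → Subset n → Set
Biconnected = IsKConnected 2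

Triconnected : {n : ℕ} → Rel n → Subset n → Set
Triconnected = IsKConnected 3

Independent : {n : ℕ} → Rel n → Subset n → Subset n → Subset n → Set
Independent E W S T = ¬ Splits E W S T × ¬ Splits E W T S

IsSingle : {n : ℕ} → Rel n → Subset n → Subset n → Set
IsSingle E W S =
  IsCutset2 E W S × (∀ T → IsCutset2 E W T → T ≢ S → Independent E W S T)

IsPart : {n : ℕ} → Rel n → Subset n → Subset n → Set
IsPart E W A =
  (∀ S → IsSingle E W S → ¬ Splits E W S A) ×
  (∀ v → v ∈ W → v ∉ A → ∃[ S ] (IsSingle E W S × Separates E W S ⁅ v ⁆ A))

GPrime : {n : ℕ} → Rel n → Subset n → Rel n
GPrime E W u v = E u v ⊎ (u ≢ v × ∃[ S ] (IsSingle E W S × u ∈ S × v ∈ S))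

IsBlock : {n : ℕ} → Rel n → Subset n → Subset n → Set
IsBlock E W A = IsPart E W A × Triconnected (GPrime E W) A

Colorable : {n : ℕ} → Rel n → Subset n → ℕ → Set
Colorable {n} E X k =
  Σ ((v : Fin n) → v ∈ X → Fin k) λ f →
    ∀ u v (pu : u ∈ X) (pv : v ∈ X) → E u v → f u pu ≢ f v pv

IsChromatic : {n : ℕ} → Rel n → Subset n → ℕ → Set
IsChromatic E X k = Colorable E X k × (∀ j → Colorable E X j → k ≤ j)

IsMaxChromatic : {n : ℕ} → Rel n → (Subset n → Set) → ℕ → Set
IsMaxChromatic E P m =
  (∀ A → P A → ∀ d → IsChromatic E A d → d ≤ m) ×
  (∃[ A ] (P A × IsChromatic E A m))

{-# OPTIONS --safe #-}
module Submission where

-- Say that a graph on X is extendable if every admissible colouring of a seed (one vertex, or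
-- the two vertices of a cut) extends to X. If a cut T that does not split the seed splits X, the
-- side of T containing the seed is coloured first and the other side afterwards with T ∩ X as
-- prescribed; so only leaves, sets that cannot be cut further, have to be extendable.
-- (1) With single cutsets as cuts, a leaf lies in a part, and cuts are edges of G′, so a colouring
--     of G′(A) only needs its colours permuted.
-- (2) In G a spare colour corrects the colours of the seed.
-- (3) With all 2-vertex cutsets as cuts, a leaf that is still split by some cutset T ends up with T
--     crossing its seed, and has at most three vertices. A leaf with at least four vertices which
--     no 2-vertex cutset splits is contained in a maximal such set A. Among the cutsets separating
--     v ∉ A from A, one with the largest component at v is single and contained in A; therefore
--     A is a part, and paths between vertices of A shortcut to G′(A), which makes A a block.

open import Defs
open import Data.Bool using (true; false)
import Data.Bool.Properties as Bool
open import Data.Empty using (⊥-elim)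
open import Data.Fin using (Fin; zero; suc; fromℕ; inject₁; inject≤)
open import Data.Fin.Permutation.Components using (transpose; transpose-inverse)
open import Data.Fin.Properties using (_≟_; any?; all?; fromℕ≢inject₁; inject₁-injective; inject≤-injective)
open import Data.Fin.Subset using (Subset; _∈_; _∉_; _⊆_; _⊈_; _⊂_; _⊃_; _∪_; _─_; _-_; ∣_∣; ⁅_⁆; ⊤; ⊥; Nonempty)
open import Data.Fin.Subset.Induction using (Acc; acc; ⊂-wellFounded; ⊃-wellFounded)
open import Data.Fin.Subset.Properties using (_∈?_; _⊆?_; anySubset?; nonempty?; Empty-unique; ∣⊥∣≡0; ∣⊤∣≡n; ∣⁅x⁆∣≡1; ∈⊤; ⊆⊤; x∈⁅x⁆; x∈⁅y⁆⇒x≡y; x∈p∪q⁺; x∈p∪q⁻; p⊆p∪q; p⊆q⇒∣p∣≤∣q∣; ∪-comm; ∪-identityˡ; ∪-identityʳ; ∪-idem; p─⊥≡p; p─q⊆p; x∈p∧x∉q⇒x∈p─q; x∈p∧x≢y⇒x∈p-y; x∈p⇒p-x⊂p; x∈p⇒∣p-x∣<∣p∣)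
open import Data.Nat using (ℕ; zero; suc; _≤_; _<_; _⊔_; z≤n; s≤s; _≤?_)
open import Data.Nat.Properties using (≤-refl; ≤-trans; ≤-reflexive; ≤-pred; ≰⇒>; <⇒≱; <-≤-trans; n≮0; n≮n; ≤∧≢⇒<; suc-injective; m≤n⊔m; m≤m⊔n; m≤n⇒m≤1+n) renaming (_≟_ to _≟ℕ_)
open import Data.Product using (_×_; _,_; proj₁; proj₂; ∃; ∃-syntax)
open import Data.Sum using (_⊎_; inj₁; inj₂; [_,_]′; swap)
open import Data.Vec using (Vec; []; _∷_; there; tabulate; lookup)
open import Data.Vec.Properties using (lookup∘tabulate; lookup⇒[]=; []=⇒lookup; ≡-dec)
open import Function using (_∘_; id; case_of_)
open import Relation.Nullary using (¬_; Dec; yes; no; does; contradiction)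
open import Relation.Nullary.Decidable using (map′; ¬?; _×-dec_; _⊎-dec_; _→-dec_; decidable-stable; dec-true; dec-false)
open import Relation.Binary.PropositionalEquality using (_≡_; _≢_; refl; sym; trans; cong; subst; subst₂)

-- Finite subsets

⟪_⟫ : ∀ {n} {P : Fin n → Set} → (∀ v → Dec (P v)) → Subset n
⟪ P? ⟫ = tabulate (λ v → does (P? v))

∈⟪⟫⁺ : ∀ {n} {P : Fin n → Set} (P? : ∀ v → Dec (P v)) {v} → P v → v ∈ ⟪ P? ⟫
∈⟪⟫⁺ P? {v} p = lookup⇒[]= v _ (trans (lookup∘tabulate _ v) (dec-true (P? v) p))

∈⟪⟫⁻ : ∀ {n} {P : Fin n → Set} (P? : ∀ v → Dec (P v)) {v} → v ∈ ⟪ P? ⟫ → P v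
∈⟪⟫⁻ P? {v} v∈ with P? v | trans (sym (lookup∘tabulate (λ w → does (P? w)) v)) ([]=⇒lookup v∈)
... | yes p | _ = p
... | no _  | ()

allSubset? : ∀ {n} {P : Subset n → Set} → (∀ S → Dec (P S)) → Dec (∀ S → P S)
allSubset? P? = map′ (λ ¬∃ S → decidable-stable (P? S) (λ ¬p → ¬∃ (S , ¬p)))
                     (λ ∀P (S , ¬p) → ¬p (∀P S))
                     (¬? (anySubset? (λ S → ¬? (P? S))))

x∈p─q⇒x∉q : ∀ {n} {p q : Subset n} {x} → x ∈ p ─ q → x ∉ q
x∈p─q⇒x∉q {p = true ∷ _}  {true ∷ _}  {zero}  () _
x∈p─q⇒x∉q {p = false ∷ _} {true ∷ _}  {zero}  () _
x∈p─q⇒x∉q {p = _ ∷ _}     {false ∷ _} {zero}  _ ()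
x∈p─q⇒x∉q {p = _ ∷ p}     {_ ∷ q}     {suc x} (there x∈) (there x∈q) = x∈p─q⇒x∉q {p = p} {q} x∈ x∈q

∣p∣≤1+∣p-x∣ : ∀ {n} (p : Subset n) x → ∣ p ∣ ≤ suc ∣ p - x ∣
∣p∣≤1+∣p-x∣ (true ∷ p)  zero    = s≤s (≤-reflexive (cong ∣_∣ (sym (p─⊥≡p p))))
∣p∣≤1+∣p-x∣ (false ∷ p) zero    = m≤n⇒m≤1+n (≤-reflexive (cong ∣_∣ (sym (p─⊥≡p p))))
∣p∣≤1+∣p-x∣ (true ∷ p)  (suc x) = s≤s (∣p∣≤1+∣p-x∣ p x)
∣p∣≤1+∣p-x∣ (false ∷ p) (suc x) = ∣p∣≤1+∣p-x∣ p x

0<∣p∣⇒Nonempty : ∀ {n} {p : Subset n} → 0 < ∣ p ∣ → Nonempty p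
0<∣p∣⇒Nonempty {n} {p} 0<∣p∣ with nonempty? p
... | yes ne = ne
... | no ¬ne = contradiction (subst (0 <_) (trans (cong ∣_∣ (Empty-unique ¬ne)) (∣⊥∣≡0 n)) 0<∣p∣) n≮0

∣p∣≡0⇒p≡⊥ : ∀ {n} {p : Subset n} → ∣ p ∣ ≡ 0 → p ≡ ⊥
∣p∣≡0⇒p≡⊥ {p = p} eq = Empty-unique λ (x , x∈p) → n≮0 (subst (∣ p - x ∣ <_) eq (x∈p⇒∣p-x∣<∣p∣ x∈p))

k<∣p-x∣ : ∀ {n k} (p : Subset n) x → suc k < ∣ p ∣ → k < ∣ p - x ∣
k<∣p-x∣ p x lt = ≤-pred (≤-trans lt (∣p∣≤1+∣p-x∣ p x))

x∈p-y⁻ : ∀ {n} (p : Subset n) y {x} → x ∈ p - y → x ∈ p × x ≢ y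
x∈p-y⁻ p y x∈ = p─q⊆p p ⁅ y ⁆ x∈ , λ { refl → x∈p─q⇒x∉q {p = p} x∈ (x∈⁅x⁆ y) }

3<∣p∣⇒fresh : ∀ {n} {p : Subset n} → 3 < ∣ p ∣ → ∀ a b c → ∃[ y ] (y ∈ p × y ≢ a × y ≢ b × y ≢ c)
3<∣p∣⇒fresh {p = p} 3<∣p∣ a b c
  with y , y∈abc ← 0<∣p∣⇒Nonempty (k<∣p-x∣ (p - a - b) c (k<∣p-x∣ (p - a) b (k<∣p-x∣ p a 3<∣p∣)))
  with y∈ab , y≢c ← x∈p-y⁻ (p - a - b) c y∈abc
  with y∈a , y≢b ← x∈p-y⁻ (p - a) b y∈ab
  with y∈ , y≢a ← x∈p-y⁻ p a y∈a
  = y , y∈ , y≢a , y≢b , y≢c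

third : ∀ {k} → 3 ≤ k → (i j : Fin k) → ∃[ r ] (r ≢ i × r ≢ j)
third {k} 3≤k i j
  with r , r∈ij ← 0<∣p∣⇒Nonempty (k<∣p-x∣ (⊤ - i) j (k<∣p-x∣ ⊤ i (subst (3 ≤_) (sym (∣⊤∣≡n k)) 3≤k)))
  with r∈i , r≢j ← x∈p-y⁻ (⊤ - i) j r∈ij
  = r , proj₂ (x∈p-y⁻ ⊤ i r∈i) , r≢j

pair : ∀ {n} → Fin n → Fin n → Subset n
pair a b = ⁅ a ⁆ ∪ ⁅ b ⁆

module _ {n : ℕ} {a b : Fin n} where

  ∈pairˡ : a ∈ pair a b
  ∈pairˡ = x∈p∪q⁺ (inj₁ (x∈⁅x⁆ a))

  ∈pairʳ : b ∈ pair a b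
  ∈pairʳ = x∈p∪q⁺ (inj₂ (x∈⁅x⁆ b))

  ∈pair⁻ : ∀ {z} → z ∈ pair a b → z ≡ a ⊎ z ≡ b
  ∈pair⁻ z∈ with x∈p∪q⁻ ⁅ a ⁆ ⁅ b ⁆ z∈
  ... | inj₁ z∈a = inj₁ (x∈⁅y⁆⇒x≡y a z∈a)
  ... | inj₂ z∈b = inj₂ (x∈⁅y⁆⇒x≡y b z∈b)

  ∉pair : ∀ {z} → z ≢ a → z ≢ b → z ∉ pair a b
  ∉pair z≢a z≢b z∈ = [ z≢a , z≢b ]′ (∈pair⁻ z∈)

  ∉pair⇒≢ˡ : ∀ {z} → z ∉ pair a b → z ≢ a
  ∉pair⇒≢ˡ z∉ refl = z∉ ∈pairˡ

  ∉pair⇒≢ʳ : ∀ {z} → z ∉ pair a b → z ≢ b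
  ∉pair⇒≢ʳ z∉ refl = z∉ ∈pairʳ

pair-comm : ∀ {n} (a b : Fin n) → pair a b ≡ pair b a
pair-comm a b = ∪-comm ⁅ a ⁆ ⁅ b ⁆

∣pair∣≡2 : ∀ {n} {a b : Fin n} → a ≢ b → ∣ pair a b ∣ ≡ 2
∣pair∣≡2 {a = zero}  {zero}  a≢b = contradiction refl a≢b
∣pair∣≡2 {a = zero}  {suc b} _   = cong suc (trans (cong ∣_∣ (∪-identityˡ ⁅ b ⁆)) (∣⁅x⁆∣≡1 b))
∣pair∣≡2 {a = suc a} {zero}  _   = cong suc (trans (cong ∣_∣ (∪-identityʳ ⁅ a ⁆)) (∣⁅x⁆∣≡1 a))
∣pair∣≡2 {a = suc a} {suc b} a≢b = ∣pair∣≡2 (a≢b ∘ cong suc)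

∣p∣≡1⇒p≡⁅a⁆ : ∀ {n} (p : Subset n) → ∣ p ∣ ≡ 1 → ∃[ a ] p ≡ ⁅ a ⁆
∣p∣≡1⇒p≡⁅a⁆ (true ∷ p)  eq = zero , cong (true ∷_) (∣p∣≡0⇒p≡⊥ (suc-injective eq))
∣p∣≡1⇒p≡⁅a⁆ (false ∷ p) eq with ∣p∣≡1⇒p≡⁅a⁆ p eq
... | a , refl = suc a , refl

∣p∣≡2⇒p≡pair : ∀ {n} (p : Subset n) → ∣ p ∣ ≡ 2 → ∃[ a ] ∃[ b ] p ≡ pair a b
∣p∣≡2⇒p≡pair (true ∷ p)  eq with ∣p∣≡1⇒p≡⁅a⁆ p (suc-injective eq)
... | b , refl = zero , suc b , cong (true ∷_) (sym (∪-identityˡ ⁅ b ⁆))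
∣p∣≡2⇒p≡pair (false ∷ p) eq with ∣p∣≡2⇒p≡pair p eq
... | a , b , refl = suc a , suc b , refl

∣p∣≤3⇒⊆triple : ∀ {n} {p : Subset n} → ∣ p ∣ ≤ 3 → ∀ {s t} → s ∈ p → t ∈ p → s ≢ t →
                ∃[ r ] (∀ {z} → z ∈ p → z ∉ pair s t → z ≡ r)
∣p∣≤3⇒⊆triple {p = p} ∣p∣≤3 {s} {t} s∈ t∈ s≢t with nonempty? (p - s - t)
... | no ¬ne = s , λ z∈ z∉ → ⊥-elim (¬ne (_ , x∈p∧x≢y⇒x∈p-y (x∈p∧x≢y⇒x∈p-y z∈ (∉pair⇒≢ˡ z∉)) (∉pair⇒≢ʳ z∉)))
... | yes (r , r∈) = r , λ {z} z∈ z∉ → decidable-stable (z ≟ r) λ z≢r →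
      let z∈′ = x∈p∧x≢y⇒x∈p-y (x∈p∧x≢y⇒x∈p-y (x∈p∧x≢y⇒x∈p-y z∈ (∉pair⇒≢ˡ z∉)) (∉pair⇒≢ʳ z∉)) z≢r
          ∣1∣ = ≤-pred (≤-trans (x∈p⇒∣p-x∣<∣p∣ s∈) ∣p∣≤3)
          ∣2∣ = ≤-pred (≤-trans (x∈p⇒∣p-x∣<∣p∣ (x∈p∧x≢y⇒x∈p-y t∈ (s≢t ∘ sym))) ∣1∣)
          ∣3∣ = ≤-pred (≤-trans (x∈p⇒∣p-x∣<∣p∣ r∈) ∣2∣)
      in n≮0 (<-≤-trans (x∈p⇒∣p-x∣<∣p∣ z∈′) ∣3∣)

-- Colourings

module _ {k : ℕ} where

  transpose-ˡ : (i j : Fin k) → transpose i j i ≡ j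
  transpose-ˡ i j rewrite dec-true (i ≟ i) refl = refl

  transpose-fix : {i j l : Fin k} → l ≢ i → l ≢ j → transpose i j l ≡ l
  transpose-fix {i} {j} {l} l≢i l≢j rewrite dec-false (l ≟ i) l≢i | dec-false (l ≟ j) l≢j = refl

  transpose-injective : (i j : Fin k) {x y : Fin k} → transpose i j x ≡ transpose i j y → x ≡ y
  transpose-injective i j eq =
    trans (sym (transpose-inverse j i)) (trans (cong (transpose j i) eq) (transpose-inverse j i))

  -- Two transpositions suffice: the first takes `p` to `i`, the second takes the image of `q` to
  -- `j`. The second fixes `i`, because `i` differs from that image and from `j`.
  recolour : (p q i j : Fin k) → (p ≡ q → i ≡ j) → (i ≡ j → p ≡ q) →
             ∃[ π ] ((∀ {x y : Fin k} → π x ≡ π y → x ≡ y) × π p ≡ i × π q ≡ j)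
  recolour p q i j ⇒ ⇐ with p ≟ q
  ... | yes refl = transpose p i , transpose-injective p i , transpose-ˡ p i , trans (transpose-ˡ p i) (⇒ refl)
  ... | no p≢q = transpose q′ j ∘ transpose p i
               , transpose-injective p i ∘ transpose-injective q′ j
               , trans (cong (transpose q′ j) (transpose-ˡ p i)) (transpose-fix i≢q′ (p≢q ∘ ⇐))
               , transpose-ˡ q′ j
    where
    q′ = transpose p i q
    i≢q′ : i ≢ q′
    i≢q′ eq = p≢q (transpose-injective p i (trans (transpose-ˡ p i) eq))

Proper : ∀ {n k} → Rel n → Subset n → (Fin n → Fin k) → Set
Proper D X f = ∀ u v → u ∈ X → v ∈ X → D u v → f u ≢ f v

proper⇒colorable : ∀ {n k} {D : Rel n} {X} {f : Fin n → Fin k} → Proper D X f → Colorable D X k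
proper⇒colorable {f = f} proper = (λ v _ → f v) , λ u v u∈ v∈ → proper u v u∈ v∈

module _ {n : ℕ} {D : Rel n} {X : Subset n} where

  -- Colourings defined on all vertices can be compared and glued without carrying membership
  -- proofs; `Proper` never looks at the values outside `X`.
  totalise : ∀ {k} → Fin k → Colorable D X k → ∃[ f ] Proper {k = k} D X f
  totalise {k} default (f , f-proper) = g , g-proper
    where
    g : Fin n → Fin k
    g v with v ∈? X
    ... | yes v∈ = f v v∈
    ... | no _   = default
    g-proper : Proper D X g
    g-proper u v u∈ v∈ d with u ∈? X | v ∈? X
    ... | yes u∈′ | yes v∈′ = f-proper u v u∈′ v∈′ d
    ... | no u∉   | _       = contradiction u∈ u∉
    ... | _       | no v∉   = contradiction v∈ v∉

  colorable-subset : ∀ {k Y} → Y ⊆ X → Colorable D X k → Colorable D Y k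
  colorable-subset Y⊆X (f , proper) = (λ v v∈ → f v (Y⊆X v∈)) , λ u v u∈ v∈ → proper u v (Y⊆X u∈) (Y⊆X v∈)

  colorable-≤ : ∀ {j k} → j ≤ k → Colorable D X j → Colorable D X k
  colorable-≤ j≤k (f , proper) = (λ v v∈ → inject≤ (f v v∈) j≤k)
                               , λ u v u∈ v∈ d eq → proper u v u∈ v∈ d (inject≤-injective j≤k j≤k _ _ eq)

colorable-sub : ∀ {n} {D D′ : Rel n} → (∀ {u v} → D u v → D′ u v) → ∀ {X k} → Colorable D′ X k → Colorable D X k
colorable-sub D⊆D′ (f , proper) = f , λ u v u∈ v∈ d → proper u v u∈ v∈ (D⊆D′ d)

anyVec? : ∀ {k n} {P : Vec (Fin k) n → Set} → (∀ f → Dec (P f)) → Dec (∃ P)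
anyVec? {n = zero}  P? = map′ (λ p → [] , p) (λ { ([] , p) → p }) (P? [])
anyVec? {n = suc n} P? = map′ (λ (c , f , p) → c ∷ f , p) (λ { (c ∷ f , p) → c , f , p })
                              (any? (λ c → anyVec? (λ f → P? (c ∷ f))))

-- Functions cannot be enumerated directly, so the search runs over their tables. With no colours
-- `totalise` has no default value, and only the empty set is colourable.
colorable? : ∀ {n} {D : Rel n} → (∀ u v → Dec (D u v)) → ∀ X k → Dec (Colorable D X k)
colorable? {D = D} D? X zero with nonempty? X
... | yes (x , x∈) = no λ (f , _) → case f x x∈ of λ ()
... | no ¬ne       = yes ((λ v v∈ → ⊥-elim (¬ne (v , v∈))) , λ u v u∈ → ⊥-elim (¬ne (u , u∈)))
colorable? {D = D} D? X (suc k) =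
  map′ (λ (f , proper) → proper⇒colorable {f = lookup f} proper) toVec
       (anyVec? λ f → all? λ u → all? λ v → (u ∈? X) →-dec ((v ∈? X) →-dec (D? u v →-dec ¬? (lookup f u ≟ lookup f v))))
  where
  toVec : Colorable D X (suc k) → ∃[ f ] Proper D X (lookup f)
  toVec col with totalise zero col
  ... | g , proper = tabulate g , λ u v u∈ v∈ d eq →
        proper u v u∈ v∈ d (trans (sym (lookup∘tabulate g u)) (trans eq (lookup∘tabulate g v)))

-- A precoloured pair

module _ {n : ℕ} {D : Rel n} (D-sym : ∀ {u v} → D u v → D v u) (D-irrefl : ∀ {v} → ¬ D v v) where

  -- Permuting the colours keeps a colouring proper, so only equality or inequality at `s` and `t`
  -- has to match the prescription.
  repair : ∀ {k X s t} {g c : Fin n → Fin k} → Proper D X g → (g s ≡ g t → c s ≡ c t) → (c s ≡ c t → g s ≡ g t) →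
           ∃[ f ] (Proper {k = k} D X f × f s ≡ c s × f t ≡ c t)
  repair {s = s} {t} {g} {c} proper ⇒ ⇐ with recolour (g s) (g t) (c s) (c t) ⇒ ⇐
  ... | π , π-inj , πs , πt = π ∘ g , (λ u v u∈ v∈ d eq → proper u v u∈ v∈ d (π-inj eq)) , πs , πt

  module _ {k : ℕ} (S : Subset n) (i : Fin k) (g : Fin n → Fin k) where

    override : Fin n → Fin k
    override v with v ∈? S
    ... | yes _ = i
    ... | no _  = g v

    override-∈ : ∀ {v} → v ∈ S → override v ≡ i
    override-∈ {v} v∈ with v ∈? S
    ... | yes _ = refl
    ... | no v∉ = contradiction v∈ v∉

    override-∉ : ∀ {v} → v ∉ S → override v ≡ g v
    override-∉ {v} v∉ with v ∈? S
    ... | yes v∈ = contradiction v∈ v∉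
    ... | no _   = refl

    override-proper : ∀ {X} → Proper D X g → (∀ {v} → v ∈ X → v ∉ S → g v ≢ i) →
                      (∀ {u v} → u ∈ S → v ∈ S → ¬ D u v) → Proper D X override
    override-proper proper g≢i S-indep u v u∈ v∈ d with u ∈? S | v ∈? S
    ... | yes u∈S | yes v∈S = contradiction d (S-indep u∈S v∈S)
    ... | yes _   | no v∉S  = g≢i v∈ v∉S ∘ sym
    ... | no u∉S  | yes _   = g≢i u∈ u∉S
    ... | no _    | no _    = proper u v u∈ v∈ d

  -- One colour in excess suffices: it is given to both vertices or to one of them.
  spare-colour : ∀ {m X A} → X ⊆ A → Colorable D A m → ∀ {s t} → t ∈ X → (c : Fin n → Fin (suc m)) →
                 (D s t → c s ≢ c t) → ∃[ f ] (Proper {k = suc m} D X f × f s ≡ c s × f t ≡ c t)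
  spare-colour {m} {X} {A} X⊆A (f , f-proper) {s} {t} t∈ c ok = result
    where
    new : Fin (suc m)
    new = fromℕ m
    g : Fin n → Fin (suc m)
    g v with v ∈? A
    ... | yes v∈ = inject₁ (f v v∈)
    ... | no _   = new
    g≢new : ∀ {v} → v ∈ X → g v ≢ new
    g≢new {v} v∈ with v ∈? A
    ... | yes _ = fromℕ≢inject₁ ∘ sym
    ... | no v∉ = contradiction (X⊆A v∈) v∉
    g-proper : Proper D X g
    g-proper u v u∈ v∈ d with u ∈? A | v ∈? A
    ... | yes u∈′ | yes v∈′ = λ eq → f-proper u v u∈′ v∈′ d (inject₁-injective eq)
    ... | no u∉   | _       = contradiction (X⊆A u∈) u∉
    ... | _       | no v∉   = contradiction (X⊆A v∈) v∉
    both-indep : c s ≡ c t → ∀ {u v} → u ∈ pair s t → v ∈ pair s t → ¬ D u v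
    both-indep eq u∈ v∈ d with ∈pair⁻ u∈ | ∈pair⁻ v∈
    ... | inj₁ refl | inj₁ refl = D-irrefl d
    ... | inj₁ refl | inj₂ refl = ok d eq
    ... | inj₂ refl | inj₁ refl = ok (D-sym d) eq
    ... | inj₂ refl | inj₂ refl = D-irrefl d
    one-indep : ∀ {u v} → u ∈ ⁅ s ⁆ → v ∈ ⁅ s ⁆ → ¬ D u v
    one-indep u∈ v∈ d with x∈⁅y⁆⇒x≡y s u∈ | x∈⁅y⁆⇒x≡y s v∈
    ... | refl | refl = D-irrefl d
    result : ∃[ h ] (Proper {k = suc m} D X h × h s ≡ c s × h t ≡ c t)
    result with c s ≟ c t
    ... | yes eq = repair {c = c} (override-proper (pair s t) new g g-proper (λ v∈ _ → g≢new v∈) (both-indep eq))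
                     (λ _ → eq)
                     (λ _ → trans (override-∈ (pair s t) new g {s} ∈pairˡ) (sym (override-∈ (pair s t) new g {t} ∈pairʳ)))
    ... | no neq = repair {c = c} (override-proper ⁅ s ⁆ new g g-proper (λ v∈ _ → g≢new v∈) one-indep)
                     (λ eq → contradiction (trans (sym (override-∉ ⁅ s ⁆ new g t∉)) (trans (sym eq) (override-∈ ⁅ s ⁆ new g (x∈⁅x⁆ s)))) (g≢new t∈))
                     (λ eq → contradiction eq neq)
      where
      t∉ : t ∉ ⁅ s ⁆
      t∉ t∈s = neq (cong c (sym (x∈⁅y⁆⇒x≡y s t∈s)))

  -- Three colours leave one that differs from both prescribed colours; it goes to the only further
  -- vertex, `r`.
  triple-colour : ∀ {k X} → 3 ≤ k → ∀ {s t r} → s ≢ t → (∀ {z} → z ∈ X → z ∉ pair s t → z ≡ r) →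
                  (c : Fin n → Fin k) → (D s t → c s ≢ c t) →
                  ∃[ f ] (Proper {k = k} D X f × f s ≡ c s × f t ≡ c t)
  triple-colour {k} {X} 3≤k {s} {t} {r} s≢t X⊆ c ok with third 3≤k (c s) (c t)
  ... | i , i≢s , i≢t = f , f-proper , f-pair ∈pairˡ , f-pair ∈pairʳ
    where
    f : Fin n → Fin k
    f v with v ∈? pair s t
    ... | yes _ = c v
    ... | no _  = i
    f-pair : ∀ {v} → v ∈ pair s t → f v ≡ c v
    f-pair {v} v∈ with v ∈? pair s t
    ... | yes _ = refl
    ... | no v∉ = contradiction v∈ v∉
    c≢i : ∀ {v} → v ∈ pair s t → c v ≢ i
    c≢i v∈ with ∈pair⁻ v∈
    ... | inj₁ refl = i≢s ∘ sym
    ... | inj₂ refl = i≢t ∘ sym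
    f-proper : Proper D X f
    f-proper u v u∈ v∈ d with u ∈? pair s t | v ∈? pair s t
    ... | yes u∈p | no _    = c≢i u∈p
    ... | no _    | yes v∈p = c≢i v∈p ∘ sym
    ... | no u∉p  | no v∉p  = ⊥-elim (D-irrefl (subst₂ D (X⊆ u∈ u∉p) (X⊆ v∈ v∉p) d))
    ... | yes u∈p | yes v∈p with ∈pair⁻ u∈p | ∈pair⁻ v∈p
    ...   | inj₁ refl | inj₁ refl = contradiction d D-irrefl
    ...   | inj₁ refl | inj₂ refl = ok d
    ...   | inj₂ refl | inj₁ refl = ok (D-sym d) ∘ sym
    ...   | inj₂ refl | inj₂ refl = contradiction d D-irrefl

  small-colour : ∀ {k X} → 3 ≤ k → ∣ X ∣ ≤ 3 → ∀ {s t} → s ∈ X → t ∈ X →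
                 (c : Fin n → Fin k) → (D s t → c s ≢ c t) →
                 ∃[ f ] (Proper {k = k} D X f × f s ≡ c s × f t ≡ c t)
  small-colour {k} {X} 3≤k ∣X∣≤3 {s} {t} s∈ t∈ c ok with s ≟ t
  ... | no s≢t = triple-colour 3≤k s≢t (proj₂ (∣p∣≤3⇒⊆triple ∣X∣≤3 s∈ t∈ s≢t)) c ok
  ... | yes refl with any? (λ p → (p ∈? X) ×-dec ¬? (p ≟ s))
  ...   | no ¬p = c , (λ u v u∈ v∈ d → ⊥-elim (D-irrefl (subst₂ D (only u∈) (only v∈) d))) , refl , refl
    where
    only : ∀ {z} → z ∈ X → z ≡ s
    only {z} z∈ = decidable-stable (z ≟ s) (λ z≢s → ¬p (z , z∈ , z≢s))
  -- A one-vertex seed is reduced to a pair: a second vertex `p` of `X` gets a prescribed colour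
  -- other than `c s`.
  ...   | yes (p , p∈ , p≢s) with third 3≤k (c s) (c s)
  ...     | i , i≢s , _ with triple-colour 3≤k (p≢s ∘ sym) (proj₂ (∣p∣≤3⇒⊆triple ∣X∣≤3 s∈ p∈ (p≢s ∘ sym))) c′ (λ _ → c′s≢c′p)
    where
    c′ : Fin n → Fin k
    c′ = override ⁅ p ⁆ i c
    c′s≢c′p : c′ s ≢ c′ p
    c′s≢c′p eq = i≢s (trans (sym (override-∈ ⁅ p ⁆ i c (x∈⁅x⁆ p))) (trans (sym eq) (override-∉ ⁅ p ⁆ i c (p≢s ∘ sym ∘ x∈⁅y⁆⇒x≡y p))))
  ...       | f , proper , fs , _ = f , proper , fs′ , fs′
    where
    fs′ = trans fs (override-∉ ⁅ p ⁆ i c (p≢s ∘ sym ∘ x∈⁅y⁆⇒x≡y p))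

-- Reachability

module _ {n : ℕ} {E : Rel n} where

  start∈ : ∀ {X u v} → Reach E X u v → u ∈ X
  start∈ (here u∈)     = u∈
  start∈ (step u∈ _ _) = u∈

  end∈ : ∀ {X u v} → Reach E X u v → v ∈ X
  end∈ (here v∈)    = v∈
  end∈ (step _ _ r) = end∈ r

  reach-trans : ∀ {X u v w} → Reach E X u v → Reach E X v w → Reach E X u w
  reach-trans (here _)      r′ = r′
  reach-trans (step u∈ e r) r′ = step u∈ e (reach-trans r r′)

  reach-snoc : ∀ {X u v w} → Reach E X u v → E v w → w ∈ X → Reach E X u w
  reach-snoc r e w∈ = reach-trans r (step (end∈ r) e (here w∈))

  reach-sym : (∀ {u v} → E u v → E v u) → ∀ {X u v} → Reach E X u v → Reach E X v u
  reach-sym E-sym (here u∈)     = here u∈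
  reach-sym E-sym (step u∈ e r) = reach-snoc (reach-sym E-sym r) (E-sym e) u∈

  reach-confined : ∀ {X Y u v} → (∀ {z} → Reach E X u z → z ∈ Y) → Reach E X u v → Reach E Y u v
  reach-confined X⇒Y (here u∈)     = here (X⇒Y (here u∈))
  reach-confined X⇒Y (step u∈ e r) = step (X⇒Y (here u∈)) e (reach-confined (λ r′ → X⇒Y (step u∈ e r′)) r)

  -- Dropping everything up to the last visit to `u` leaves a path avoiding `u`. Hence a search for
  -- paths may delete each vertex that it leaves, and terminates.
  last-visit : ∀ {X w v} u → Reach E X w v →
               Reach E (X - u) w v ⊎ u ≡ v ⊎ ∃[ w′ ] (E u w′ × Reach E (X - u) w′ v)
  last-visit {v = v} u (here v∈) with u ≟ v
  ... | yes u≡v = inj₂ (inj₁ u≡v)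
  ... | no u≢v  = inj₁ (here (x∈p∧x≢y⇒x∈p-y v∈ (u≢v ∘ sym)))
  last-visit {w = w} u (step w∈ e r) with last-visit u r
  ... | inj₂ rest = inj₂ rest
  ... | inj₁ r′ with u ≟ w
  ...   | yes refl = inj₂ (inj₂ (_ , e , r′))
  ...   | no u≢w   = inj₁ (step (x∈p∧x≢y⇒x∈p-y w∈ (u≢w ∘ sym)) e r′)

  module _ (E? : ∀ u v → Dec (E u v)) where

    reach-acc? : ∀ X → Acc _⊂_ X → ∀ u v → Dec (Reach E X u v)
    reach-acc? X (acc rs) u v with u ∈? X
    ... | no u∉  = no (u∉ ∘ start∈)
    ... | yes u∈ with u ≟ v
    ...   | yes refl = yes (here u∈)
    ...   | no u≢v   = map′ (λ (w , e , r) → step u∈ e (reach-confined (proj₁ ∘ x∈p-y⁻ X u ∘ end∈) r))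
                            depart
                            (any? (λ w → E? u w ×-dec reach-acc? (X - u) (rs (x∈p⇒p-x⊂p u∈)) w v))
      where
      depart : Reach E X u v → ∃[ w ] (E u w × Reach E (X - u) w v)
      depart r with last-visit u r
      ... | inj₁ r′          = contradiction refl (proj₂ (x∈p-y⁻ X u (start∈ r′)))
      ... | inj₂ (inj₁ u≡v)  = contradiction u≡v u≢v
      ... | inj₂ (inj₂ next) = next

    reach? : ∀ X u v → Dec (Reach E X u v)
    reach? X = reach-acc? X (⊂-wellFounded X)

∈⊤─⁺ : ∀ {n} {S : Subset n} {z} → z ∉ S → z ∈ ⊤ ─ S
∈⊤─⁺ = x∈p∧x∉q⇒x∈p─q ∈⊤

∈⊤─⁻ : ∀ {n} {S : Subset n} {z} → z ∈ ⊤ ─ S → z ∉ S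
∈⊤─⁻ {S = S} = x∈p─q⇒x∉q {p = ⊤} {S}

-- Splitting, single cutsets and parts

module Graph {n : ℕ} {E : Rel n} (simple : IsSimpleGraph E) where

  E-sym : ∀ {u v} → E u v → E v u
  E-sym = IsSimpleGraph.sym simple _ _

  E-irrefl : ∀ {v} → ¬ E v v
  E-irrefl = IsSimpleGraph.irrefl simple _

  E? : ∀ u v → Dec (E u v)
  E? = IsSimpleGraph.dec simple

  infix 4 _∼[_]_
  _∼[_]_ : Fin n → Subset n → Fin n → Set
  u ∼[ S ] v = Reach E (⊤ ─ S) u v

  _∼[_]?_ : ∀ u S v → Dec (u ∼[ S ] v)
  u ∼[ S ]? v = reach? E? (⊤ ─ S) u v

  ∼-sym : ∀ {S u v} → u ∼[ S ] v → v ∼[ S ] u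
  ∼-sym = reach-sym E-sym

  start∉ : ∀ {S u v} → u ∼[ S ] v → u ∉ S
  start∉ {S} = ∈⊤─⁻ {S = S} ∘ start∈

  end∉ : ∀ {S u v} → u ∼[ S ] v → v ∉ S
  end∉ {S} = ∈⊤─⁻ {S = S} ∘ end∈

  ∼-confined : ∀ {S T u v} → (∀ {z} → u ∼[ S ] z → z ∉ T) → u ∼[ S ] v → u ∼[ T ] v
  ∼-confined f = reach-confined (∈⊤─⁺ ∘ f)

  ∼-step : ∀ {S u v} → E u v → u ∉ S → v ∉ S → u ∼[ S ] v
  ∼-step e u∉ v∉ = step (∈⊤─⁺ u∉) e (here (∈⊤─⁺ v∉))

  Splitting : Subset n → Subset n → Set
  Splitting S X = Splits E ⊤ S X

  splits? : ∀ S X → Dec (Splitting S X)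
  splits? S X = any? λ x → any? λ y →
    (x ∈? X) ×-dec (¬? (x ∈? S) ×-dec ((y ∈? X) ×-dec (¬? (y ∈? S) ×-dec ¬? (x ∼[ S ]? y))))

  unsplit⇒∼ : ∀ {S X} → ¬ Splitting S X → ∀ {x y} → x ∈ X → x ∉ S → y ∈ X → y ∉ S → x ∼[ S ] y
  unsplit⇒∼ {S} ¬sp {x} {y} x∈ x∉ y∈ y∉ =
    decidable-stable (x ∼[ S ]? y) λ x≁y → ¬sp (x , y , x∈ , x∉ , y∈ , y∉ , x≁y)

  splits-mono : ∀ {S X Y} → X ⊆ Y → Splitting S X → Splitting S Y
  splits-mono X⊆Y (x , y , x∈ , x∉ , y∈ , rest) = x , y , X⊆Y x∈ , x∉ , X⊆Y y∈ , rest

  ¬splits-self : ∀ {S} → ¬ Splitting S S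
  ¬splits-self (_ , _ , x∈ , x∉ , _) = x∉ x∈

  ¬splits-diagonal : ∀ {S x} → ¬ Splitting S (pair x x)
  ¬splits-diagonal (_ , _ , u∈ , u∉ , v∈ , _ , u≁v) with ∈pair⁻ u∈ | ∈pair⁻ v∈
  ... | inj₁ refl | inj₁ refl = u≁v (here (∈⊤─⁺ u∉))
  ... | inj₁ refl | inj₂ refl = u≁v (here (∈⊤─⁺ u∉))
  ... | inj₂ refl | inj₁ refl = u≁v (here (∈⊤─⁺ u∉))
  ... | inj₂ refl | inj₂ refl = u≁v (here (∈⊤─⁺ u∉))

  cutset2? : ∀ S → Dec (IsCutset2 E ⊤ S)
  cutset2? S = ((S ⊆? ⊤) ×-dec any? λ u → any? λ v → (u ∈? ⊤ ─ S) ×-dec ((v ∈? ⊤ ─ S) ×-dec ¬? (u ∼[ S ]? v)))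
               ×-dec (∣ S ∣ ≟ℕ 2)

  _≟ₛ_ : (S T : Subset n) → Dec (S ≡ T)
  _≟ₛ_ = ≡-dec Bool._≟_

  independent? : ∀ S T → Dec (Independent E ⊤ S T)
  independent? S T = ¬? (splits? S T) ×-dec ¬? (splits? T S)

  single? : ∀ S → Dec (IsSingle E ⊤ S)
  single? S = cutset2? S ×-dec allSubset? λ T → cutset2? T →-dec (¬? (T ≟ₛ S) →-dec independent? S T)

  single⇒cutset2 : ∀ {S} → IsSingle E ⊤ S → IsCutset2 E ⊤ S
  single⇒cutset2 = proj₁

  separates? : ∀ S X Y → Dec (Separates E ⊤ S X Y)
  separates? S X Y = ¬? (X ⊆? S) ×-dec (¬? (Y ⊆? S) ×-dec
    (all? λ x → all? λ y → (x ∈? X) →-dec (¬? (x ∈? S) →-dec ((y ∈? Y) →-dec (¬? (y ∈? S) →-dec ¬? (x ∼[ S ]? y))))))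

  part? : ∀ A → Dec (IsPart E ⊤ A)
  part? A = (allSubset? λ S → single? S →-dec ¬? (splits? S A))
    ×-dec all? λ v → (v ∈? ⊤) →-dec (¬? (v ∈? A) →-dec anySubset? λ S → single? S ×-dec separates? S ⁅ v ⁆ A)

  E′ : Rel n
  E′ = GPrime E ⊤

  E′? : ∀ u v → Dec (E′ u v)
  E′? u v = E? u v ⊎-dec (¬? (u ≟ v) ×-dec anySubset? λ S → single? S ×-dec ((u ∈? S) ×-dec (v ∈? S)))

  E′-sym : ∀ {u v} → E′ u v → E′ v u
  E′-sym (inj₁ e) = inj₁ (E-sym e)
  E′-sym (inj₂ (u≢v , S , S∈ , u∈ , v∈)) = inj₂ (u≢v ∘ sym , S , S∈ , v∈ , u∈)

  E′-irrefl : ∀ {v} → ¬ E′ v v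
  E′-irrefl (inj₁ e) = E-irrefl e
  E′-irrefl (inj₂ (v≢v , _)) = v≢v refl

  single-unsplit : ∀ {S T} → IsSingle E ⊤ S → IsSingle E ⊤ T → ¬ Splitting S T
  single-unsplit {S} {T} (cut , indep) (cut′ , _) with T ≟ₛ S
  ... | yes refl = ¬splits-self
  ... | no T≢S   = proj₁ (indep T cut′ T≢S)

  -- An added edge joins two vertices of a single cutset `T`, and `S` does not split `T`. Hence
  -- colourings of G′, too, can be glued along single cutsets.
  E′-not-across : ∀ {S} → IsSingle E ⊤ S → ∀ {u v} → E′ u v → u ∉ S → v ∉ S → u ∼[ S ] v
  E′-not-across S∈ (inj₁ e) = ∼-step e
  E′-not-across S∈ (inj₂ (_ , T , T∈ , u∈ , v∈)) u∉ v∉ = unsplit⇒∼ (single-unsplit S∈ T∈) u∈ u∉ v∈ v∉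

  Separated : Subset n → Fin n → Subset n → Set
  Separated S v A = v ∉ S × (∀ {z} → z ∈ A → z ∉ S → ¬ v ∼[ S ] z)

  separates⇒separated : ∀ {S v A} → Separates E ⊤ S ⁅ v ⁆ A → Separated S v A
  separates⇒separated {S} {v} (v⊈S , _ , ≁) = v∉S , λ z∈ z∉ → ≁ v _ (x∈⁅x⁆ v) v∉S z∈ z∉
    where
    v∉S : v ∉ S
    v∉S v∈S = v⊈S λ x∈ → subst (_∈ S) (sym (x∈⁅y⁆⇒x≡y v x∈)) v∈S

  separated⇒separates : ∀ {S v A} → Separated S v A → A ⊈ S → Separates E ⊤ S ⁅ v ⁆ A
  separated⇒separates {S} {v} {A} (v∉S , ≁) A⊈S = (λ v⊆S → v∉S (v⊆S (x∈⁅x⁆ v))) , A⊈S , far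
    where
    far : ∀ x y → x ∈ ⁅ v ⁆ → x ∉ S → y ∈ A → y ∉ S → ¬ x ∼[ S ] y
    far x y x∈ _ y∈ y∉ with x∈⁅y⁆⇒x≡y v x∈
    ... | refl = ≁ y∈ y∉

  module Cuts {𝒞 : Subset n → Set} (𝒞? : ∀ S → Dec (𝒞 S)) where

    Unsplit : Subset n → Set
    Unsplit X = ∀ S → 𝒞 S → ¬ Splitting S X

    split? : ∀ X → Dec (∃[ S ] (𝒞 S × Splitting S X))
    split? X = anySubset? λ S → 𝒞? S ×-dec splits? S X

    -- A pair witnessing the new splitting must consist of `v` and a vertex of `A`. Outside `S`, all
    -- of `A` lies in one component, so `v` is cut off from the whole of it.
    split-extension : ∀ {S A v} → ¬ Splitting S A → Splitting S (A ∪ ⁅ v ⁆) → Separates E ⊤ S ⁅ v ⁆ A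
    split-extension {S} {A} {v} ¬sp (x , y , x∈ , x∉ , y∈ , y∉ , x≁y)
      with x∈p∪q⁻ A ⁅ v ⁆ x∈ | x∈p∪q⁻ A ⁅ v ⁆ y∈
    ... | inj₁ x∈A | inj₁ y∈A = contradiction (unsplit⇒∼ ¬sp x∈A x∉ y∈A y∉) x≁y
    ... | inj₁ x∈A | inj₂ y∈v with x∈⁅y⁆⇒x≡y v y∈v
    ...   | refl = separated⇒separates (y∉ , λ z∈ z∉ y∼z → x≁y (reach-trans (unsplit⇒∼ ¬sp x∈A x∉ z∈ z∉) (∼-sym y∼z)))
                                       (λ A⊆S → x∉ (A⊆S x∈A))
    split-extension {S} {A} {v} ¬sp (x , y , x∈ , x∉ , y∈ , y∉ , x≁y)
        | inj₂ x∈v | inj₁ y∈A with x∈⁅y⁆⇒x≡y v x∈v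
    ...   | refl = separated⇒separates (x∉ , λ z∈ z∉ x∼z → x≁y (reach-trans x∼z (unsplit⇒∼ ¬sp z∈ z∉ y∈A y∉)))
                                       (λ A⊆S → y∉ (A⊆S y∈A))
    split-extension {S} {A} {v} ¬sp (x , y , x∈ , x∉ , y∈ , y∉ , x≁y)
        | inj₂ x∈v | inj₂ y∈v with x∈⁅y⁆⇒x≡y v x∈v | x∈⁅y⁆⇒x≡y v y∈v
    ...   | refl | refl = contradiction (here (∈⊤─⁺ x∉)) x≁y

    -- Vertices are added as long as no cut splits the enlarged set. Once this stops, adding any
    -- outside `v` creates a splitting, and `split-extension` separates `v` from the set.
    saturate : ∀ X → Unsplit X →
      ∃[ A ] (X ⊆ A × Unsplit A × (∀ v → v ∉ A → ∃[ S ] (𝒞 S × Separates E ⊤ S ⁅ v ⁆ A)))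
    saturate X = go X (⊃-wellFounded X)
      where
      go : ∀ X → Acc _⊃_ X → Unsplit X →
           ∃[ A ] (X ⊆ A × Unsplit A × (∀ v → v ∉ A → ∃[ S ] (𝒞 S × Separates E ⊤ S ⁅ v ⁆ A)))
      go X (acc rs) unsplit with any? (λ v → ¬? (v ∈? X) ×-dec ¬? (split? (X ∪ ⁅ v ⁆)))
      ... | no ¬grow = X , id , unsplit , λ v v∉ →
            let S , S∈ , sp = decidable-stable (split? (X ∪ ⁅ v ⁆)) (λ ¬sp → ¬grow (v , v∉ , ¬sp))
            in S , S∈ , split-extension (unsplit S S∈) sp
      ... | yes (v , v∉ , ¬sp)
        with A , X∪v⊆A , rest ← go (X ∪ ⁅ v ⁆) (rs (p⊆p∪q ⁅ v ⁆ , v , x∈p∪q⁺ (inj₂ (x∈⁅x⁆ v)) , v∉))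
                                   (λ S S∈ sp → ¬sp (S , S∈ , sp))
        = A , (λ x∈ → X∪v⊆A (p⊆p∪q ⁅ v ⁆ x∈)) , rest

  module Singles = Cuts single?

  unsplit⊆part : ∀ {X} → Singles.Unsplit X → ∃[ A ] (X ⊆ A × IsPart E ⊤ A)
  unsplit⊆part {X} unsplit with A , X⊆A , unsplitA , sep ← Singles.saturate X unsplit =
    A , X⊆A , unsplitA , λ v _ v∉ → sep v v∉

  -- Gluing colourings along cuts

  module Extension {D : Rel n} (D-sym : ∀ {u v} → D u v → D v u) (D-irrefl : ∀ {v} → ¬ D v v)
                   {𝒞 : Subset n → Set} (𝒞? : ∀ S → Dec (𝒞 S)) (∣𝒞∣≡2 : ∀ {S} → 𝒞 S → ∣ S ∣ ≡ 2)
                   (not-across : ∀ {S} → 𝒞 S → ∀ {u v} → D u v → u ∉ S → v ∉ S → u ∼[ S ] v)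
                   (k : ℕ) where

    -- The case `s ≡ t` encodes a one-vertex seed, which arises when the side coloured second meets
    -- the cut in at most one vertex.
    Seed : Fin n → Fin n → Set
    Seed s t = s ≡ t ⊎ 𝒞 (pair s t)

    ExtendableFrom : Subset n → Fin n → Fin n → Set
    ExtendableFrom X s t = (c : Fin n → Fin k) → (D s t → c s ≢ c t) →
      ∃[ f ] (Proper {k = k} D X f × f s ≡ c s × f t ≡ c t)

    Extendable : Subset n → Set
    Extendable X = ∀ {s t} → Seed s t → s ∈ X → t ∈ X → ExtendableFrom X s t

    -- A cut is usable for the recursion only if it leaves the seed unsplit, so that the seed lies
    -- on one side. On a leaf no usable cut splits `X`.
    Leaf : Subset n → Fin n → Fin n → Set
    Leaf X s t = ∀ T → 𝒞 T → Splitting T X → Splitting T (pair s t)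

    -- The vertices of the cut that lie in `X` form the seed. If there are none, nothing is
    -- prescribed and any vertex of `X` can be the seed; hence the nonemptiness.
    extend-cut : ∀ {X} → Extendable X → Nonempty X → ∀ {a b} → 𝒞 (pair a b) → (c : Fin n → Fin k) →
                 (a ∈ X → b ∈ X → D a b → c a ≢ c b) →
                 ∃[ f ] (Proper {k = k} D X f × (∀ {z} → z ∈ X → z ∈ pair a b → f z ≡ c z))
    extend-cut {X} ext (x , x∈) {a} {b} ab∈ c ok with a ∈? X | b ∈? X
    ... | yes a∈ | yes b∈ with f , proper , fa , fb ← ext (inj₂ ab∈) a∈ b∈ c (ok a∈ b∈) =
      f , proper , λ _ z∈ → case ∈pair⁻ z∈ of λ { (inj₁ refl) → fa ; (inj₂ refl) → fb }
    ... | yes a∈ | no b∉ with f , proper , fa , _ ← ext (inj₁ refl) a∈ a∈ c (⊥-elim ∘ D-irrefl) =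
      f , proper , λ z∈X z∈ → case ∈pair⁻ z∈ of λ { (inj₁ refl) → fa ; (inj₂ refl) → contradiction z∈X b∉ }
    ... | no a∉ | yes b∈ with f , proper , fb , _ ← ext (inj₁ refl) b∈ b∈ c (⊥-elim ∘ D-irrefl) =
      f , proper , λ z∈X z∈ → case ∈pair⁻ z∈ of λ { (inj₁ refl) → contradiction z∈X a∉ ; (inj₂ refl) → fb }
    ... | no a∉ | no b∉ with f , proper , _ ← ext (inj₁ refl) x∈ x∈ c (⊥-elim ∘ D-irrefl) =
      f , proper , λ z∈X z∈ → case ∈pair⁻ z∈ of λ { (inj₁ refl) → contradiction z∈X a∉ ; (inj₂ refl) → contradiction z∈X b∉ }

    module Split (X T : Subset n) (T∈ : 𝒞 T) (x : Fin n) where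

      -- Vertices of `T` in `X` belong to both sides: to the near one explicitly, to the far one
      -- because no path avoiding `T` ends in `T`.
      near? : ∀ z → Dec (z ∈ X × (x ∼[ T ] z ⊎ z ∈ T))
      near? z = (z ∈? X) ×-dec ((x ∼[ T ]? z) ⊎-dec (z ∈? T))

      far? : ∀ z → Dec (z ∈ X × ¬ x ∼[ T ] z)
      far? z = (z ∈? X) ×-dec ¬? (x ∼[ T ]? z)

      near⊆X : ⟪ near? ⟫ ⊆ X
      near⊆X = proj₁ ∘ ∈⟪⟫⁻ near?

      far⊆X : ⟪ far? ⟫ ⊆ X
      far⊆X = proj₁ ∘ ∈⟪⟫⁻ far?

      ∈T⇒near : ∀ {z} → z ∈ X → z ∈ T → z ∈ ⟪ near? ⟫
      ∈T⇒near z∈X z∈T = ∈⟪⟫⁺ near? (z∈X , inj₂ z∈T)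

      ∈T⇒far : ∀ {z} → z ∈ X → z ∈ T → z ∈ ⟪ far? ⟫
      ∈T⇒far z∈X z∈T = ∈⟪⟫⁺ far? (z∈X , λ r → end∉ r z∈T)

      glue : ∀ {f g : Fin n → Fin k} → Proper D ⟪ near? ⟫ f → Proper D ⟪ far? ⟫ g →
             (∀ {z} → z ∈ X → z ∈ T → f z ≡ g z) →
             ∃[ h ] (Proper {k = k} D X h × (∀ {z} → z ∈ ⟪ near? ⟫ → h z ≡ f z) × (∀ {z} → z ∈ ⟪ far? ⟫ → h z ≡ g z))
      glue {f} {g} f-proper g-proper agree = h , h-proper , h-near , h-far
        where
        h : Fin n → Fin k
        h z with x ∼[ T ]? z
        ... | yes _ = f z
        ... | no _  = g z
        h-near : ∀ {z} → z ∈ ⟪ near? ⟫ → h z ≡ f z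
        h-near {z} z∈ with x ∼[ T ]? z | ∈⟪⟫⁻ near? z∈
        ... | yes _ | _               = refl
        ... | no ≁  | _ , inj₁ ∼      = contradiction ∼ ≁
        ... | no _  | z∈X , inj₂ z∈T  = sym (agree z∈X z∈T)
        h-far : ∀ {z} → z ∈ ⟪ far? ⟫ → h z ≡ g z
        h-far {z} z∈ with x ∼[ T ]? z
        ... | yes ∼ = contradiction ∼ (proj₂ (∈⟪⟫⁻ far? z∈))
        ... | no _  = refl
        -- No edge runs across the cut, so an edge leaving the component of `x` ends in `T`. Every
        -- edge therefore lies within one side.
        neighbour-near : ∀ {u v} → x ∼[ T ] u → v ∈ X → D u v → v ∈ ⟪ near? ⟫
        neighbour-near {u} {v} x∼u v∈ d with v ∈? T
        ... | yes v∈T = ∈T⇒near v∈ v∈T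
        ... | no v∉T  = ∈⟪⟫⁺ near? (v∈ , inj₁ (reach-trans x∼u (not-across T∈ d (end∉ x∼u) v∉T)))
        near-edge : ∀ {u v} → u ∈ ⟪ near? ⟫ → v ∈ ⟪ near? ⟫ → D u v → h u ≢ h v
        near-edge u∈ v∈ d eq = f-proper _ _ u∈ v∈ d (trans (sym (h-near u∈)) (trans eq (h-near v∈)))
        h-proper : Proper D X h
        h-proper u v u∈ v∈ d = by-sides (x ∼[ T ]? u) (x ∼[ T ]? v)
          where
          by-sides : Dec (x ∼[ T ] u) → Dec (x ∼[ T ] v) → h u ≢ h v
          by-sides (yes x∼u) _ = near-edge (∈⟪⟫⁺ near? (u∈ , inj₁ x∼u)) (neighbour-near x∼u v∈ d) d
          by-sides _ (yes x∼v) = near-edge (neighbour-near x∼v u∈ (D-sym d)) (∈⟪⟫⁺ near? (v∈ , inj₁ x∼v)) d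
          by-sides (no x≁u) (no x≁v) eq =
            let u∈′ = ∈⟪⟫⁺ far? (u∈ , x≁u)
                v∈′ = ∈⟪⟫⁺ far? (v∈ , x≁v)
            in g-proper u v u∈′ v∈′ d (trans (sym (h-far u∈′)) (trans eq (h-far v∈′)))

      companion-near : ∀ {s t} → ¬ Splitting T (pair s t) → x ∼[ T ] s → t ∈ X → t ∈ ⟪ near? ⟫
      companion-near {s} {t} ¬sp x∼s t∈ with t ∈? T
      ... | yes t∈T = ∈T⇒near t∈ t∈T
      ... | no t∉T  = ∈⟪⟫⁺ near? (t∈ , inj₁ (reach-trans x∼s (unsplit⇒∼ ¬sp ∈pairˡ (end∉ x∼s) ∈pairʳ t∉T)))

      one-side : ∀ {s t} → ¬ Splitting T (pair s t) → s ∈ X → t ∈ X →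
                 (s ∈ ⟪ near? ⟫ × t ∈ ⟪ near? ⟫) ⊎ (s ∈ ⟪ far? ⟫ × t ∈ ⟪ far? ⟫)
      one-side {s} {t} ¬sp s∈ t∈ with x ∼[ T ]? s | x ∼[ T ]? t
      ... | yes x∼s | _      = inj₁ (∈⟪⟫⁺ near? (s∈ , inj₁ x∼s) , companion-near ¬sp x∼s t∈)
      ... | no _ | yes x∼t   = inj₁ (companion-near (¬sp ∘ subst (Splitting T) (pair-comm t s)) x∼t s∈ , ∈⟪⟫⁺ near? (t∈ , inj₁ x∼t))
      ... | no x≁s | no x≁t  = inj₂ (∈⟪⟫⁺ far? (s∈ , x≁s) , ∈⟪⟫⁺ far? (t∈ , x≁t))

      extend-split : ∀ {a b} → T ≡ pair a b → Extendable ⟪ near? ⟫ → Nonempty ⟪ near? ⟫ → Extendable ⟪ far? ⟫ → Nonempty ⟪ far? ⟫ →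
                     ∀ {s t} → Seed s t → s ∈ X → t ∈ X → ¬ Splitting T (pair s t) → ExtendableFrom X s t
      extend-split {a} {b} refl near ne-near far ne-far seed s∈ t∈ ¬sp c ok with one-side ¬sp s∈ t∈
      ... | inj₁ (s∈n , t∈n)
        with f , f-proper , fs , ft ← near seed s∈n t∈n c ok
        with g , g-proper , g≡f ← extend-cut far ne-far T∈ f
               -- Adjacent vertices of the cut already differ, since those in `X` lie on the side
               -- coloured first as well.
               (λ a∈ b∈ → f-proper a b (∈T⇒near (far⊆X a∈) ∈pairˡ) (∈T⇒near (far⊆X b∈) ∈pairʳ))
        with h , h-proper , h-near , _ ← glue f-proper g-proper (λ z∈X z∈T → sym (g≡f (∈T⇒far z∈X z∈T) z∈T))
        = h , h-proper , trans (h-near s∈n) fs , trans (h-near t∈n) ft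
      ... | inj₂ (s∈f , t∈f)
        with g , g-proper , gs , gt ← far seed s∈f t∈f c ok
        with f , f-proper , f≡g ← extend-cut near ne-near T∈ g
               (λ a∈ b∈ → g-proper a b (∈T⇒far (near⊆X a∈) ∈pairˡ) (∈T⇒far (near⊆X b∈) ∈pairʳ))
        with h , h-proper , _ , h-far ← glue f-proper g-proper (λ z∈X z∈T → f≡g (∈T⇒near z∈X z∈T) z∈T)
        = h , h-proper , trans (h-far s∈f) gs , trans (h-far t∈f) gt

    extend : (∀ {X s t} → Seed s t → s ∈ X → t ∈ X → Leaf X s t → ExtendableFrom X s t) → ∀ X → Extendable X
    extend leaf X = go X (⊂-wellFounded X)
      where
      go : ∀ X → Acc _⊂_ X → Extendable X
      go X (acc rs) {s} {t} seed s∈ t∈ with anySubset? (λ T → 𝒞? T ×-dec (splits? T X ×-dec ¬? (splits? T (pair s t))))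
      ... | no ¬T = leaf seed s∈ t∈ λ T T∈ sp → decidable-stable (splits? T (pair s t)) (λ ¬sp → ¬T (T , T∈ , sp , ¬sp))
      ... | yes (T , T∈ , (x , y , x∈ , x∉ , y∈ , y∉ , x≁y) , ¬sp)
        with a , b , T≡ab ← ∣p∣≡2⇒p≡pair T (∣𝒞∣≡2 T∈)
        = extend-split T≡ab
            -- Both sides are smaller than `X`: the near one misses `y`, the far one misses `x`.
            (go _ (rs (near⊆X , y , y∈ , λ y∈n → [ x≁y , y∉ ]′ (proj₂ (∈⟪⟫⁻ near? y∈n)))))
            (x , ∈⟪⟫⁺ near? (x∈ , inj₁ x∼x))
            (go _ (rs (far⊆X , x , x∈ , λ x∈f → proj₂ (∈⟪⟫⁻ far? x∈f) x∼x)))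
            (y , ∈⟪⟫⁺ far? (y∈ , x≁y))
            seed s∈ t∈ ¬sp
        where
        open Split X T T∈ x
        x∼x : x ∼[ T ] x
        x∼x = here (∈⊤─⁺ x∉)

    leaves⇒colorable : (∀ {X s t} → Seed s t → s ∈ X → t ∈ X → Leaf X s t → ExtendableFrom X s t) →
                       Fin n → Fin k → Colorable D ⊤ k
    leaves⇒colorable leaf v i with f , proper , _ ← extend leaf ⊤ {v} (inj₁ refl) ∈⊤ ∈⊤ (λ _ → i) (⊥-elim ∘ D-irrefl) =
      proper⇒colorable proper

  -- Crossing cutsets

  Cutset2 : Subset n → Set
  Cutset2 = IsCutset2 E ⊤

  pair-cutset2 : ∀ {a b u v} → a ≢ b → u ∉ pair a b → v ∉ pair a b → ¬ u ∼[ pair a b ] v → Cutset2 (pair a b)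
  pair-cutset2 a≢b u∉ v∉ u≁v = (⊆⊤ , _ , _ , ∈⊤─⁺ u∉ , ∈⊤─⁺ v∉ , u≁v) , ∣pair∣≡2 a≢b

  module Cutset2s = Cuts cutset2?

  -- Before it reaches t, a path avoiding s and p stays in the component of x in G − {s, t}, so it
  -- misses q.
  corner : ∀ {s t p q x} → x ∉ pair s t → x ≢ p → t ∉ pair p q → ¬ x ∼[ pair s t ] q →
           x ∼[ pair s p ] t → x ∼[ pair p q ] t
  corner {s} {t} {p} {q} = go
    where
    go : ∀ {x} → x ∉ pair s t → x ≢ p → t ∉ pair p q → ¬ x ∼[ pair s t ] q → x ∼[ pair s p ] t → x ∼[ pair p q ] t
    go x∉ x≢p t∉ x≁q (here _) = contradiction ∈pairʳ x∉
    go {x} x∉ x≢p t∉ x≁q (step {w = w} _ e r) = reach-trans (∼-step e x∉pq w∉pq) rest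
      where
      x∉pq : x ∉ pair p q
      x∉pq = ∉pair x≢p λ { refl → x≁q (here (∈⊤─⁺ x∉)) }
      next : w ≢ t → w ∉ pair s t × ¬ w ∼[ pair s t ] q
      next w≢t = w∉ , λ w∼q → x≁q (reach-trans (∼-step e x∉ w∉) w∼q)
        where w∉ = ∉pair (∉pair⇒≢ˡ (start∉ r)) w≢t
      rest : w ∼[ pair p q ] t
      rest with w ≟ t
      ... | yes refl = here (∈⊤─⁺ t∉)
      ... | no w≢t with w∉ , w≁q ← next w≢t = go w∉ (∉pair⇒≢ʳ (start∉ r)) t∉ w≁q r
      w∉pq : w ∉ pair p q
      w∉pq = start∉ rest

  -- Each pair separates the other. By `near` and `p≁q`, exactly two components remain without `s`
  -- and `t`, one containing `p` and one containing `q`.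
  record Crossing (s t p q : Fin n) : Set where
    field
      s∉   : s ∉ pair p q
      t∉   : t ∉ pair p q
      p∉   : p ∉ pair s t
      q∉   : q ∉ pair s t
      s≁t  : ¬ s ∼[ pair p q ] t
      p≁q  : ¬ p ∼[ pair s t ] q
      near : ∀ {w} → w ∉ pair s t → w ∼[ pair s t ] p ⊎ w ∼[ pair s t ] q

    s≢t : s ≢ t
    s≢t refl = s≁t (here (∈⊤─⁺ s∉))

  open Crossing

  crossing-swapˡ : ∀ {s t p q} → Crossing s t p q → Crossing t s p q
  crossing-swapˡ {s} {t} {p} {q} X = record
    { s∉ = t∉ X ; t∉ = s∉ X
    ; p∉ = subst (p ∉_) (pair-comm s t) (p∉ X)
    ; q∉ = subst (q ∉_) (pair-comm s t) (q∉ X)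
    ; s≁t = s≁t X ∘ ∼-sym
    ; p≁q = subst (λ S → ¬ p ∼[ S ] q) (pair-comm s t) (p≁q X)
    ; near = subst (λ S → ∀ {w} → w ∉ S → w ∼[ S ] p ⊎ w ∼[ S ] q) (pair-comm s t) (near X)
    }

  crossing-swapʳ : ∀ {s t p q} → Crossing s t p q → Crossing s t q p
  crossing-swapʳ {s} {t} {p} {q} X = record
    { s∉ = subst (s ∉_) (pair-comm p q) (s∉ X)
    ; t∉ = subst (t ∉_) (pair-comm p q) (t∉ X)
    ; p∉ = q∉ X ; q∉ = p∉ X
    ; s≁t = subst (λ S → ¬ s ∼[ S ] t) (pair-comm p q) (s≁t X)
    ; p≁q = p≁q X ∘ ∼-sym
    ; near = swap ∘ near X
    }

  component : Subset n → Fin n → Subset n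
  component S v = ⟪ v ∼[ S ]?_ ⟫

  -- The component at `v` is the measure for improving cutsets: a new cutset `T` that avoids it
  -- preserves it, and reaching a vertex of the old `S` makes it strictly larger.
  component-⊂ : ∀ {S T v w} → (∀ {z} → v ∼[ S ] z → z ∉ T) → v ∼[ T ] w → w ∈ S → component S v ⊂ component T v
  component-⊂ {S} {T} {v} {w} avoids v∼w w∈S =
      (λ z∈ → ∈⟪⟫⁺ (v ∼[ T ]?_) (∼-confined avoids (∈⟪⟫⁻ (v ∼[ S ]?_) z∈)))
    , w , ∈⟪⟫⁺ (v ∼[ T ]?_) v∼w , λ w∈ → end∉ (∈⟪⟫⁻ (v ∼[ S ]?_) w∈) w∈S

  -- 2-vertex cutsets of a biconnected graph

  module Biconnectivity (biconnected : Biconnected E ⊤) where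

    ∣R∣<2⇒∼ : ∀ {R u v} → ∣ R ∣ < 2 → u ∉ R → v ∉ R → u ∼[ R ] v
    ∣R∣<2⇒∼ {R} {u} {v} lt u∉ v∉ = decidable-stable (u ∼[ R ]? v) λ u≁v →
      proj₂ biconnected R lt (⊆⊤ , u , v , ∈⊤─⁺ u∉ , ∈⊤─⁺ v∉ , u≁v)

    -- Deleting `b` alone leaves the graph connected, so a path leads from `u` to `a`; it is stopped
    -- just before its first visit to `a`. Thus every component left by the pair is adjacent to both
    -- its vertices.
    approachˡ : ∀ {a b u} → a ≢ b → u ∉ pair a b → ∃[ c ] (u ∼[ pair a b ] c × E c a)
    approachˡ {a} {b} {u} a≢b u∉ =
      go (∣R∣<2⇒∼ (subst (_< 2) (sym (∣⁅x⁆∣≡1 b)) ≤-refl) (∉pair⇒≢ʳ u∉ ∘ x∈⁅y⁆⇒x≡y b) (a≢b ∘ x∈⁅y⁆⇒x≡y b)) u∉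
      where
      go : ∀ {w} → w ∼[ ⁅ b ⁆ ] a → w ∉ pair a b → ∃[ c ] (w ∼[ pair a b ] c × E c a)
      go (here _) w∉ = contradiction ∈pairˡ w∉
      go (step {w = w′} _ e r) w∉ with w′ ≟ a
      ... | yes refl = _ , here (∈⊤─⁺ w∉) , e
      ... | no w′≢a with c , w′∼c , e′ ← go r (∉pair w′≢a (λ { refl → start∉ r (x∈⁅x⁆ b) })) =
        c , step (∈⊤─⁺ w∉) e w′∼c , e′

    approachʳ : ∀ {a b u} → a ≢ b → u ∉ pair a b → ∃[ c ] (u ∼[ pair a b ] c × E c b)
    approachʳ {a} {b} {u} a≢b u∉ =
      subst (λ S → ∃[ c ] (u ∼[ S ] c × E c b)) (pair-comm b a)
            (approachˡ (a≢b ∘ sym) (subst (u ∉_) (pair-comm a b) u∉))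

    split-pair⁻ : ∀ {T s t} → Splitting T (pair s t) → s ∉ T × t ∉ T × ¬ s ∼[ T ] t
    split-pair⁻ {T} sp@(x , y , x∈ , x∉ , y∈ , y∉ , x≁y) with ∈pair⁻ x∈ | ∈pair⁻ y∈
    ... | inj₁ refl | inj₂ refl = x∉ , y∉ , x≁y
    ... | inj₂ refl | inj₁ refl = y∉ , x∉ , x≁y ∘ ∼-sym
    ... | inj₁ refl | inj₁ refl = contradiction (here (∈⊤─⁺ x∉)) x≁y
    ... | inj₂ refl | inj₂ refl = contradiction (here (∈⊤─⁺ x∉)) x≁y

    -- Every component left by {s, t} contains `p` or `q`, and there are at least two of them, so
    -- `p` and `q` lie in different ones: splitting is mutual.
    crossing : ∀ {s t p q} → Cutset2 (pair s t) → Splitting (pair p q) (pair s t) → Crossing s t p q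
    crossing {s} {t} {p} {q} ((_ , u , v , u∈ , v∈ , u≁v) , _) sp
      with s∉′ , t∉′ , s≁t′ ← split-pair⁻ sp = record
      { s∉ = s∉′ ; t∉ = t∉′ ; p∉ = proj₁ pq ; q∉ = proj₁ (proj₂ pq)
      ; s≁t = s≁t′ ; p≁q = proj₂ (proj₂ pq) ; near = near′ }
      where
      s≢t′ : s ≢ t
      s≢t′ refl = s≁t′ (here (∈⊤─⁺ s∉′))
      -- A component missing both p and q would still connect s to t.
      near′ : ∀ {w} → w ∉ pair s t → w ∼[ pair s t ] p ⊎ w ∼[ pair s t ] q
      near′ {w} w∉ = decidable-stable ((w ∼[ pair s t ]? p) ⊎-dec (w ∼[ pair s t ]? q)) λ ¬near →
        let avoids : ∀ {z} → w ∼[ pair s t ] z → z ∉ pair p q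
            avoids w∼z z∈ = case ∈pair⁻ z∈ of λ { (inj₁ refl) → ¬near (inj₁ w∼z) ; (inj₂ refl) → ¬near (inj₂ w∼z) }
            c , w∼c , c-s = approachˡ s≢t′ w∉
            d , w∼d , d-t = approachʳ s≢t′ w∉
        in s≁t′ (reach-trans (∼-sym (reach-snoc (∼-confined avoids w∼c) c-s (∈⊤─⁺ s∉′)))
                             (reach-snoc (∼-confined avoids w∼d) d-t (∈⊤─⁺ t∉′)))
      u∉ : u ∉ pair s t
      u∉ = ∈⊤─⁻ u∈
      v∉ : v ∉ pair s t
      v∉ = ∈⊤─⁻ v∈
      pq : p ∉ pair s t × q ∉ pair s t × ¬ p ∼[ pair s t ] q
      pq with near′ u∉ | near′ v∉
      ... | inj₁ u∼p | inj₁ v∼p = contradiction (reach-trans u∼p (∼-sym v∼p)) u≁v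
      ... | inj₂ u∼q | inj₂ v∼q = contradiction (reach-trans u∼q (∼-sym v∼q)) u≁v
      ... | inj₁ u∼p | inj₂ v∼q = end∉ u∼p , end∉ v∼q , λ p∼q → u≁v (reach-trans u∼p (reach-trans p∼q (∼-sym v∼q)))
      ... | inj₂ u∼q | inj₁ v∼p = end∉ v∼p , end∉ u∼q , λ p∼q → u≁v (reach-trans u∼q (reach-trans (∼-sym p∼q) (∼-sym v∼p)))

    not-single⇒crossing : ∀ {a b} → Cutset2 (pair a b) → ¬ IsSingle E ⊤ (pair a b) → ∃[ p ] ∃[ q ] Crossing a b p q
    not-single⇒crossing {a} {b} cut ¬single
      with anySubset? (λ R → cutset2? R ×-dec ¬? (independent? (pair a b) R))
    ... | no ¬R = contradiction (cut , λ R R∈ _ → decidable-stable (independent? (pair a b) R) (λ ¬ind → ¬R (R , R∈ , ¬ind))) ¬single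
    ... | yes (R , R∈ , ¬ind) with p , q , refl ← ∣p∣≡2⇒p≡pair R (proj₂ R∈) = p , q , crossing cut R-splits
      where
      R-splits : Splitting (pair p q) (pair a b)
      R-splits with splits? (pair p q) (pair a b)
      ... | yes sp = sp
      -- Dependence then means that `pair a b` splits `pair p q`, and `crossing` turns this around.
      ... | no ¬sp = ⊥-elim (¬ind ((λ sp → let X = crossing R∈ sp in
              ¬sp (a , b , ∈pairˡ , p∉ X , ∈pairʳ , q∉ X , p≁q X)) , ¬sp))

    -- Leaves of the decomposition along all 2-vertex cutsets

    module _ {X : Subset n} {s t : Fin n} (s∈ : s ∈ X) (t∈ : t ∈ X)
             (leaf : ∀ T → Cutset2 T → Splitting T X → Splitting T (pair s t)) where

      ¬splits-shared : ∀ {p} → ¬ Splitting (pair s p) (pair s t)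
      ¬splits-shared sp = proj₁ (split-pair⁻ sp) ∈pairˡ

      -- Otherwise, by `corner`, {s, p} is a cutset between `z` and `t`. It splits `X` but,
      -- containing `s`, cannot split the seed.
      leaf-corner : ∀ {p q z} → Crossing s t p q → z ∈ X → z ∉ pair s t → z ≢ p →
                    ¬ z ∼[ pair s t ] q → z ∼[ pair p q ] t
      leaf-corner {p} {q} {z} C z∈ z∉ z≢p z≁q = decidable-stable (z ∼[ pair p q ]? t) λ z≁t →
        let z≁t′ = z≁t ∘ corner z∉ z≢p (t∉ C) z≁q
            z∉′ = ∉pair (∉pair⇒≢ˡ z∉) z≢p
            t∉′ = ∉pair (s≢t C ∘ sym) (∉pair⇒≢ˡ (t∉ C))
        in ¬splits-shared (leaf _ (pair-cutset2 (∉pair⇒≢ˡ (p∉ C) ∘ sym) z∉′ t∉′ z≁t′)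
                                  (z , t , z∈ , z∉′ , t∈ , t∉′ , z≁t′))

    leaf-shape : ∀ {X s t} → s ≡ t ⊎ Cutset2 (pair s t) → s ∈ X → t ∈ X →
                 (∀ T → Cutset2 T → Splitting T X → Splitting T (pair s t)) →
                 Cutset2s.Unsplit X ⊎ s ≢ t × ∃[ r ] (∀ {z} → z ∈ X → z ∉ pair s t → z ≡ r)
    leaf-shape (inj₁ refl) _ _ leaf = inj₁ λ T T∈ sp → ¬splits-diagonal (leaf T T∈ sp)
    leaf-shape {X} {s} {t} (inj₂ cut) s∈ t∈ leaf with Cutset2s.split? X
    ... | no ¬sp = inj₁ λ T T∈ sp → ¬sp (T , T∈ , sp)
    ... | yes (T , T∈ , sp) with p , q , refl ← ∣p∣≡2⇒p≡pair T (proj₂ T∈) = inj₂ (s≢t C , triple)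
      where
      C : Crossing s t p q
      C = crossing cut (leaf (pair p q) T∈ sp)
      leaf′ : ∀ T → Cutset2 T → Splitting T X → Splitting T (pair t s)
      leaf′ T T∈ sp = subst (Splitting T) (pair-comm s t) (leaf T T∈ sp)
      -- Outside the seed, `X` lies in the component of `p`. A vertex there other than `p` would
      -- reach both `s` and `t` avoiding `p` and `q`, although {p, q} separates `s` from `t`.
      only : ∀ {p q x} → Crossing s t p q → x ∈ X → x ∼[ pair s t ] p → ∀ {z} → z ∈ X → z ∉ pair s t → z ≡ p
      only {p} {q} C x∈ x∼p {z} z∈ z∉ = decidable-stable (z ≟ p) λ z≢p →
        let z∼x = unsplit⇒∼ (¬splits-self ∘ leaf (pair s t) cut) z∈ z∉ x∈ (start∉ x∼p)
            z≁q = λ z∼q → p≁q C (reach-trans (∼-sym (reach-trans z∼x x∼p)) z∼q)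
            z∼t = leaf-corner s∈ t∈ leaf C z∈ z∉ z≢p z≁q
            z∼s = leaf-corner t∈ s∈ leaf′ (crossing-swapˡ C) z∈ (subst (z ∉_) (pair-comm s t) z∉) z≢p
                    (subst (λ S → ¬ z ∼[ S ] q) (pair-comm s t) z≁q)
        in s≁t C (reach-trans (∼-sym z∼s) z∼t)
      triple : ∃[ r ] (∀ {z} → z ∈ X → z ∉ pair s t → z ≡ r)
      triple with any? (λ x → (x ∈? X) ×-dec ¬? (x ∈? pair s t))
      ... | no ¬x = s , λ z∈ z∉ → contradiction (_ , z∈ , z∉) ¬x
      ... | yes (x , x∈ , x∉) with near C x∉
      ...   | inj₁ x∼p = p , only C x∈ x∼p
      ...   | inj₂ x∼q = q , only (crossing-swapʳ C) x∈ x∼q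

    -- Large sets split by no 2-vertex cutset

    module Unsplittable {A : Subset n} (unsplit : Cutset2s.Unsplit A) (3<∣A∣ : 3 < ∣ A ∣)
                        (separator : ∀ v → v ∉ A → ∃[ S ] (Cutset2 S × Separates E ⊤ S ⁅ v ⁆ A)) where

      Larger : Subset n → Fin n → Set
      Larger T v = ∃[ S ] (Cutset2 S × Separated S v A × component T v ⊂ component S v)

      -- The new cutset is {b, p}: by `corner` it cuts `y`, and with it `A`, off from `a`. The old
      -- component of `v` misses `p`, which lies with `y`, so it survives and absorbs `a`.
      enlarge-corner : ∀ {T a b p q v y} → T ≡ pair a b → Crossing a b p q → Separated T v A →
                       y ∈ A → y ∉ pair a b → y ≢ p → y ∼[ pair a b ] p → ¬ y ∼[ pair p q ] a → Larger T v
      enlarge-corner {a = a} {b} {p} {q} {v} {y} refl C (v∉ , v≁) y∈ y∉ y≢p y∼p y≁a =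
          pair b p
        , pair-cutset2 (∉pair⇒≢ʳ (p∉ C) ∘ sym) y∉′ a∉′ y≁a′
        , (∉pair (∉pair⇒≢ʳ v∉) (λ { refl → v≁ y∈ y∉ (∼-sym y∼p) })
          , λ z∈ z∉ v∼z → y≁a′ (reach-trans (unsplit⇒∼ (unsplit _ cut) y∈ y∉′ z∈ z∉) (reach-trans (∼-sym v∼z) v∼a)))
        , component-⊂ avoids v∼a ∈pairˡ
        where
        y∉′ : y ∉ pair b p
        y∉′ = ∉pair (∉pair⇒≢ʳ y∉) y≢p
        a∉′ : a ∉ pair b p
        a∉′ = ∉pair (s≢t C) (∉pair⇒≢ˡ (s∉ C))
        y≁a′ : ¬ y ∼[ pair b p ] a
        y≁a′ = y≁a ∘ corner (subst (y ∉_) (pair-comm a b) y∉) y≢p (s∉ C)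
                 (subst (λ S → ¬ y ∼[ S ] q) (pair-comm a b) (λ y∼q → p≁q C (reach-trans (∼-sym y∼p) y∼q)))
        cut : Cutset2 (pair b p)
        cut = pair-cutset2 (∉pair⇒≢ʳ (p∉ C) ∘ sym) y∉′ a∉′ y≁a′
        avoids : ∀ {z} → v ∼[ pair a b ] z → z ∉ pair b p
        avoids v∼z = ∉pair (∉pair⇒≢ʳ (end∉ v∼z)) λ { refl → v≁ y∈ y∉ (reach-trans v∼z (∼-sym y∼p)) }
        v∼a : v ∼[ pair b p ] a
        v∼a with c , v∼c , e ← approachˡ (s≢t C) v∉ = reach-snoc (∼-confined avoids v∼c) e (∈⊤─⁺ a∉′)

      -- The rest of `A` lies in one component, say that of `p`, and a fourth vertex of `A` provides
      -- `y` other than `a`, `b` and `p`. Since {p, q} separates `a` from `b`, this `y` fails to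
      -- reach one of them, and that corner is used.
      enlarge-crossed : ∀ {a b p q v} → Cutset2 (pair a b) → Crossing a b p q → Separated (pair a b) v A → Larger (pair a b) v
      enlarge-crossed {a} {b} {p} {q} {v} cut C sep
        with y₀ , y₀∈ , y₀≢a , y₀≢b , _ ← 3<∣p∣⇒fresh 3<∣A∣ a b a = [ side C , side (crossing-swapʳ C) ]′ (near C y₀∉)
        where
        y₀∉ : y₀ ∉ pair a b
        y₀∉ = ∉pair y₀≢a y₀≢b
        side : ∀ {p q} → Crossing a b p q → y₀ ∼[ pair a b ] p → Larger (pair a b) v
        side {p} {q} C y₀∼p
          with y , y∈ , y≢a , y≢b , y≢p ← 3<∣p∣⇒fresh 3<∣A∣ a b p = by-dec (y ∼[ pair p q ]? a)
          where
          y∉ : y ∉ pair a b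
          y∉ = ∉pair y≢a y≢b
          y∼p : y ∼[ pair a b ] p
          y∼p = reach-trans (unsplit⇒∼ (unsplit _ cut) y∈ y∉ y₀∈ y₀∉) y₀∼p
          by-dec : Dec (y ∼[ pair p q ] a) → Larger (pair a b) v
          by-dec (no y≁a) = enlarge-corner refl C sep y∈ y∉ y≢p y∼p y≁a
          by-dec (yes y∼a) = enlarge-corner (pair-comm a b) (crossing-swapˡ C) sep y∈
            (subst (y ∉_) (pair-comm a b) y∉) y≢p (subst (λ S → y ∼[ S ] p) (pair-comm a b) y∼p)
            (λ y∼b → s≁t C (reach-trans (∼-sym y∼a) y∼b))

      -- Let `S` separate `b` from `A`. If `S` met the component of `v`, then, being unsplit by {a,
      -- b}, it would miss the component of any other vertex of `A`, which could then reach `b`. So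
      -- the component of `v` survives and absorbs `b`.
      enlarge-outside : ∀ {T a b v} → T ≡ pair a b → a ≢ b → IsSingle E ⊤ T → b ∉ A → Separated T v A → Larger T v
      enlarge-outside {a = a} {b} {v} refl a≢b (_ , indep) b∉A (v∉ , v≁)
        with S , S-cut , S-sep ← separator b b∉A
        with b∉S , b≁ ← separates⇒separated S-sep
        = S , S-cut , (avoids (here (∈⊤─⁺ v∉)) , λ z∈ z∉ v∼z → b≁ z∈ z∉ (reach-trans (∼-sym v∼b) v∼z))
            , component-⊂ avoids v∼b ∈pairʳ
        where
        S-unsplit : ¬ Splitting (pair a b) S
        S-unsplit = proj₁ (indep S S-cut λ { refl → b∉S ∈pairʳ })
        reach-b : ∀ {u} → u ∉ pair a b → (∀ {z} → u ∼[ pair a b ] z → z ∉ S) → u ∼[ S ] b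
        reach-b u∉ avoids with c , u∼c , e ← approachʳ a≢b u∉ = reach-snoc (∼-confined avoids u∼c) e (∈⊤─⁺ b∉S)
        avoids : ∀ {z} → v ∼[ pair a b ] z → z ∉ S
        avoids v∼z z∈S
          with y , y∈ , y≢a , y≢b , _ ← 3<∣p∣⇒fresh 3<∣A∣ a b a
          = b≁ y∈ (start∉ y∼b) (∼-sym y∼b)
          where
          y∉ : y ∉ pair a b
          y∉ = ∉pair y≢a y≢b
          y∼b : y ∼[ S ] b
          y∼b = reach-b y∉ λ y∼z′ z′∈S →
            v≁ y∈ y∉ (reach-trans v∼z (reach-trans (unsplit⇒∼ S-unsplit z∈S (end∉ v∼z) z′∈S (end∉ y∼z′)) (∼-sym y∼z′)))
        v∼b : v ∼[ S ] b
        v∼b = reach-b v∉ avoids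

      SingleSeparator : Fin n → Set
      SingleSeparator v = ∃[ S ] (IsSingle E ⊤ S × S ⊆ A × Separated S v A)

      -- Recursion on growing components at `v` replaces the choice of a largest one. A cutset that
      -- is not single is crossed by another, and a single one not inside `A` has a vertex outside
      -- `A`; either way it can be improved.
      single-separator : ∀ {v} → v ∉ A → SingleSeparator v
      single-separator {v} v∉ with S , S-cut , S-sep ← separator v v∉ =
        go S (⊃-wellFounded _) S-cut (separates⇒separated S-sep)
        where
        go : ∀ T → Acc _⊃_ (component T v) → Cutset2 T → Separated T v A → SingleSeparator v
        go T (acc rs) cut sep with a , b , refl ← ∣p∣≡2⇒p≡pair T (proj₂ cut) = by-single (single? (pair a b))
          where
          a≢b : a ≢ b
          a≢b refl with () ← trans (sym (proj₂ cut)) (trans (cong ∣_∣ (∪-idem ⁅ a ⁆)) (∣⁅x⁆∣≡1 a))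
          continue : Larger (pair a b) v → SingleSeparator v
          continue (S , S-cut , S-sep , larger) = go S (rs larger) S-cut S-sep
          by-single : Dec (IsSingle E ⊤ (pair a b)) → SingleSeparator v
          by-single (no ¬single) with p , q , C ← not-single⇒crossing cut ¬single = continue (enlarge-crossed cut C sep)
          by-single (yes single) with a ∈? A | b ∈? A
          ... | no a∉ | _      = continue (enlarge-outside (pair-comm a b) (a≢b ∘ sym) single a∉ sep)
          ... | _     | no b∉  = continue (enlarge-outside refl a≢b single b∉ sep)
          ... | yes a∈ | yes b∈ = pair a b , single , (λ z∈ → case ∈pair⁻ z∈ of λ { (inj₁ refl) → a∈ ; (inj₂ refl) → b∈ }) , sep

      -- Excursions of a path outside A start and end in one and the same single cutset, an edge of G′.
      mutual
        shortcut : ∀ {R u y} → u ∈ A → y ∈ A → u ∼[ R ] y → Reach E′ (A ─ R) u y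
        shortcut u∈ y∈ (here u∈R) = here (x∈p∧x∉q⇒x∈p─q u∈ (∈⊤─⁻ u∈R))
        shortcut {R} {u} u∈ y∈ (step {w = w} u∈R e r) with w ∈? A
        ... | yes w∈ = step (x∈p∧x∉q⇒x∈p─q u∈ (∈⊤─⁻ u∈R)) (inj₁ e) (shortcut w∈ y∈ r)
        ... | no w∉ = re-enter (single-separator w∉)
          where
          re-enter : SingleSeparator w → Reach E′ (A ─ R) u _
          re-enter (S , single , S⊆A , w∉S , w≁)
            with b , b∈S , b∼y ← excursion single S⊆A w∉ (w∉S , w≁) y∈ r
            with u ≟ b
          ... | yes refl = b∼y
          ... | no u≢b = step (x∈p∧x∉q⇒x∈p─q u∈ (∈⊤─⁻ u∈R)) (inj₂ (u≢b , S , single , u∈S , b∈S)) b∼y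
            where
            u∈S : u ∈ S
            u∈S = decidable-stable (u ∈? S) λ u∉S → w≁ u∈ u∉S (∼-step (E-sym e) w∉S u∉S)

        excursion : ∀ {R S u y} → IsSingle E ⊤ S → S ⊆ A → u ∉ A → Separated S u A → y ∈ A → u ∼[ R ] y →
                    ∃[ b ] (b ∈ S × Reach E′ (A ─ R) b y)
        excursion single S⊆A u∉ sep y∈ (here _) = contradiction y∈ u∉
        excursion {S = S} single S⊆A u∉ (u∉S , u≁) y∈ (step {w = w} _ e r) with w ∈? A
        -- As `S` lies in `A`, the next vertex `w` is again outside `S` and in the component of `u`,
        -- so one cutset guards the whole excursion.
        ... | no w∉  = excursion single S⊆A w∉ (w∉ ∘ S⊆A , λ z∈ z∉ w∼z → u≁ z∈ z∉ (reach-trans (∼-step e u∉S (w∉ ∘ S⊆A)) w∼z)) y∈ r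
        ... | yes w∈ = w , decidable-stable (w ∈? S) (λ w∉S → u≁ w∈ w∉S (∼-step e u∉S w∉S)) , shortcut w∈ y∈ r

      block : IsBlock E ⊤ A
      block = ((λ S → unsplit S ∘ single⇒cutset2) , separated-part) , 3<∣A∣ , no-cutset
        where
        separated-part : ∀ v → v ∈ ⊤ → v ∉ A → ∃[ S ] (IsSingle E ⊤ S × Separates E ⊤ S ⁅ v ⁆ A)
        separated-part v _ v∉ with S , single , _ , sep ← single-separator v∉ =
          S , single , separated⇒separates sep λ A⊆S →
            <⇒≱ 3<∣A∣ (≤-trans (≤-trans (p⊆q⇒∣p∣≤∣q∣ A⊆S) (≤-reflexive (proj₂ (single⇒cutset2 single)))) (s≤s (s≤s z≤n)))
        no-cutset : ∀ R → ∣ R ∣ < 3 → ¬ IsCutset E′ A R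
        no-cutset R ∣R∣<3 (_ , x , y , x∈ , y∈ , x≁y) with ∣ R ∣ ≟ℕ 2
        -- By `shortcut`, vertices separated in G′(A) are separated in G, so `R` would be a 2-vertex
        -- cutset splitting `A`.
        ... | yes ∣R∣≡2 = unsplit R ((⊆⊤ , x , y , ∈⊤─⁺ x∉R , ∈⊤─⁺ y∉R , x≁y′) , ∣R∣≡2)
                            (x , y , x∈A , x∉R , y∈A , y∉R , x≁y′)
          where
          x∈A = p─q⊆p A R x∈
          y∈A = p─q⊆p A R y∈
          x∉R : x ∉ R
          x∉R = x∈p─q⇒x∉q {p = A} x∈
          y∉R : y ∉ R
          y∉R = x∈p─q⇒x∉q {p = A} y∈
          x≁y′ : ¬ x ∼[ R ] y
          x≁y′ = x≁y ∘ shortcut x∈A y∈A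
        ... | no ∣R∣≢2 = x≁y (shortcut (p─q⊆p A R x∈) (p─q⊆p A R y∈)
                           (∣R∣<2⇒∼ (≤∧≢⇒< (≤-pred ∣R∣<3) ∣R∣≢2) (x∈p─q⇒x∉q {p = A} x∈) (x∈p─q⇒x∉q {p = A} y∈)))

    -- Colourings of the whole graph

    v₀ : Fin n
    v₀ = proj₁ (0<∣p∣⇒Nonempty {p = ⊤} (≤-trans (s≤s z≤n) (proj₁ biconnected)))

    ∣single∣≡2 : ∀ {S} → IsSingle E ⊤ S → ∣ S ∣ ≡ 2
    ∣single∣≡2 = proj₂ ∘ single⇒cutset2

    module _ {s t : Fin n} (seed : s ≡ t ⊎ IsSingle E ⊤ (pair s t)) {X : Subset n} where

      -- A seed is a vertex or a single cutset, and no single cutset splits either. So no single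
      -- cutset splits a leaf, which then extends to a part.
      single-leaf⊆part : (∀ T → IsSingle E ⊤ T → Splitting T X → Splitting T (pair s t)) →
                         ∃[ A ] (X ⊆ A × IsPart E ⊤ A)
      single-leaf⊆part leaf = unsplit⊆part λ T T∈ sp → seed-unsplit seed T∈ (leaf T T∈ sp)
        where
        seed-unsplit : s ≡ t ⊎ IsSingle E ⊤ (pair s t) → ∀ {T} → IsSingle E ⊤ T → ¬ Splitting T (pair s t)
        seed-unsplit (inj₁ refl) _  = ¬splits-diagonal
        seed-unsplit (inj₂ st∈)  T∈ = single-unsplit T∈ st∈

    colour-G′ : ∀ {k} → (∀ A → IsPart E ⊤ A → Colorable E′ A k) → Colorable E′ ⊤ k
    colour-G′ {k} parts = leaves⇒colorable leaf v₀ c₀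
      where
      open Extension {E′} E′-sym E′-irrefl single? ∣single∣≡2 E′-not-across k
      -- A default colour exists because `v₀` lies in some part, and that part is coloured.
      c₀ : Fin k
      c₀ with A , v₀⊆A , part ← single-leaf⊆part (inj₁ (refl {x = v₀})) {⁅ v₀ ⁆} (λ _ _ → splits-mono (p⊆p∪q ⁅ v₀ ⁆))
        = proj₁ (parts A part) v₀ (v₀⊆A (x∈⁅x⁆ v₀))
      leaf : ∀ {X s t} → Seed s t → s ∈ X → t ∈ X → Leaf X s t → ExtendableFrom X s t
      leaf {X} {s} {t} seed s∈ t∈ leafX c ok
        with A , X⊆A , part ← single-leaf⊆part seed leafX
        with g , proper ← totalise c₀ (colorable-subset X⊆A (parts A part))
        -- Distinct vertices of a seed are adjacent in G′, so the prescription and the colouring of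
        -- the part both give them different colours.
        = repair E′-sym E′-irrefl proper (g⇒c seed) (c⇒g seed)
        where
        edge : IsSingle E ⊤ (pair s t) → s ≢ t → E′ s t
        edge st∈ s≢t = inj₂ (s≢t , pair s t , st∈ , ∈pairˡ , ∈pairʳ)
        g⇒c : Seed s t → g s ≡ g t → c s ≡ c t
        g⇒c (inj₁ refl) _ = refl
        g⇒c (inj₂ st∈) eq with s ≟ t
        ... | yes refl = refl
        ... | no s≢t = contradiction eq (proper s t s∈ t∈ (edge st∈ s≢t))
        c⇒g : Seed s t → c s ≡ c t → g s ≡ g t
        c⇒g (inj₁ refl) _ = refl
        c⇒g (inj₂ st∈) eq with s ≟ t
        ... | yes refl = refl
        ... | no s≢t = contradiction eq (ok (edge st∈ s≢t))

    colour-by-parts : ∀ {m} → (∀ A → IsPart E ⊤ A → Colorable E A m) → Colorable E ⊤ (suc m)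
    colour-by-parts {m} parts = leaves⇒colorable leaf v₀ zero
      where
      open Extension {E} E-sym E-irrefl single? ∣single∣≡2 (λ _ → ∼-step) (suc m)
      leaf : ∀ {X s t} → Seed s t → s ∈ X → t ∈ X → Leaf X s t → ExtendableFrom X s t
      leaf seed _ t∈ leafX with A , X⊆A , part ← single-leaf⊆part seed leafX =
        spare-colour E-sym E-irrefl X⊆A (parts A part) t∈

    colour-by-blocks : ∀ {m} → (∀ A → IsBlock E ⊤ A → Colorable E A m) → Colorable E ⊤ (3 ⊔ suc m)
    colour-by-blocks {m} blocks = leaves⇒colorable leaf v₀ zero
      where
      open Extension {E} E-sym E-irrefl cutset2? proj₂ (λ _ → ∼-step) (3 ⊔ suc m)
      leaf : ∀ {X s t} → Seed s t → s ∈ X → t ∈ X → Leaf X s t → ExtendableFrom X s t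
      leaf {X} seed s∈ t∈ leafX with leaf-shape seed s∈ t∈ leafX
      ... | inj₂ (s≢t , r , X⊆) = triple-colour E-sym E-irrefl (m≤m⊔n 3 (suc m)) s≢t X⊆
      ... | inj₁ unsplit with ∣ X ∣ ≤? 3
      ...   | yes ∣X∣≤3 = small-colour E-sym E-irrefl (m≤m⊔n 3 (suc m)) ∣X∣≤3 s∈ t∈
      ...   | no ∣X∣≰3 with A , X⊆A , unsplitA , separator ← Cutset2s.saturate X unsplit =
              spare-colour E-sym E-irrefl X⊆A
                -- Since `3 ⊔ suc m` is `suc (2 ⊔ m)`, the block is coloured with `2 ⊔ m` colours
                -- and one is left as the spare.
                (colorable-≤ (m≤n⊔m 2 m) (blocks A (Unsplittable.block unsplitA (<-≤-trans (≰⇒> ∣X∣≰3) (p⊆q⇒∣p∣≤∣q∣ X⊆A)) separator)))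
                t∈

-- Chromatic numbers

module _ {n : ℕ} {D : Rel n} (D? : ∀ u v → Dec (D u v)) {X : Subset n} where

  least-colorable : ∀ {k} → Colorable D X (suc k) → ¬ Colorable D X k → IsChromatic D X (suc k)
  least-colorable {k} col ¬col = col , λ j colj → ≰⇒> λ j≤k → ¬col (colorable-≤ j≤k colj)

  chromatic : ∀ k → Colorable D X k → ∃[ d ] IsChromatic D X d
  chromatic zero    col = zero , col , λ _ _ → z≤n
  chromatic (suc k) col with colorable? D? X k
  ... | yes col′ = chromatic k col′
  ... | no ¬col  = suc k , least-colorable col ¬col

  colorable-bounded : ∀ {k m} → Colorable D X k → (∀ d → IsChromatic D X d → d ≤ m) → Colorable D X m
  colorable-bounded col bound with d , d-chromatic ← chromatic _ col = colorable-≤ (bound d d-chromatic) (proj₁ d-chromatic)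

theorem4 : (n : ℕ) (E : Rel n) → IsSimpleGraph E → Biconnected E ⊤ →
    (c : ℕ) → IsChromatic E ⊤ c →
    ((c′ : ℕ) → IsChromatic (GPrime E ⊤) ⊤ c′ →
    c ≤ c′ × IsMaxChromatic (GPrime E ⊤) (IsPart E ⊤) c′)
    × ((m : ℕ) → IsMaxChromatic E (IsPart E ⊤) m → c ≤ suc m)
    × ((m : ℕ) → IsMaxChromatic E (IsBlock E ⊤) m → c ≤ 3 ⊔ suc m)
    × (¬ (∃[ A ] IsBlock E ⊤ A) → c ≤ 3)
theorem4 n E simple biconnected c (E-colorable , c-least) =
    (λ c′ c′-chromatic → c-least c′ (colorable-sub inj₁ (proj₁ c′-chromatic)) , max-part c′ c′-chromatic)
  , (λ m (bound , _) → c-least (suc m) (colour-by-parts λ A part → bounded A (bound A part)))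
  , (λ m (bound , _) → c-least (3 ⊔ suc m) (colour-by-blocks λ A block → bounded A (bound A block)))
  -- Without blocks the hypothesis is vacuous even for `m = 0`, and `3 ⊔ 1` is 3.
  , (λ ¬block → c-least 3 (colour-by-blocks {0} λ A block → contradiction (A , block) ¬block))
  where
  open Graph simple
  open Biconnectivity biconnected
  bounded : ∀ {m} A → (∀ d → IsChromatic E A d → d ≤ m) → Colorable E A m
  bounded A = colorable-bounded E? (colorable-subset ⊆⊤ E-colorable)
  max-part : ∀ c′ → IsChromatic E′ ⊤ c′ → IsMaxChromatic E′ (IsPart E ⊤) c′
  max-part zero    ((f , _) , _) = case f v₀ ∈⊤ of λ ()
  max-part (suc k) (col , least) =
      (λ A _ d (_ , d-least) → d-least (suc k) (colorable-subset ⊆⊤ col))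
    -- Some part cannot be coloured with `k` colours: otherwise `colour-G′` would colour all of G′
    -- with one colour fewer than its chromatic number.
    , attained (anySubset? λ A → part? A ×-dec ¬? (colorable? E′? A k))
    where
    attained : Dec (∃[ A ] (IsPart E ⊤ A × ¬ Colorable E′ A k)) → ∃[ A ] (IsPart E ⊤ A × IsChromatic E′ A (suc k))
    attained (yes (A , part , ¬col)) = A , part , least-colorable E′? (colorable-subset ⊆⊤ col) ¬col
    attained (no ¬A) = contradiction (least k (colour-G′ λ A part →
      decidable-stable (colorable? E′? A k) (λ ¬col → ¬A (A , part , ¬col)))) (n≮n k)
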